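{- Let $F=(V;E,A)$ be a mixed graph and $r_1,\dots,r_k\in V$. Let $U_i\subseteq V$ $(i=1,\dots,k)$ be the set of vertices reachable from $r_i$ by a mixed path in $F$. Then there exists a packing of $r_i$-mixed arborescences $(i=1,\dots,k)$ spanning $U_i$ in $F$ if and only if $$e_E(\mathcal{P})+\sum_{s=1}^t\rho_A(\mathsf{X}^s)\ \geq\ \sum_{s=1}^t\left|\left\{ i\in\{1,\dots,k\}\ \middle|\ (\mathsf{X}^s)_I\subseteq U_i,\ r_i\notin (\mathsf{X}^s)_I,\ ((\mathsf{X}^s)_O\setminus (\mathsf{X}^s)_I)\cap U_i=\emptyset \right\}\right|$$ holds for every family of bi-sets $\{\mathsf{X}^1,\dots,\mathsf{X}^t\}$ for which there is an atom $\Gamma_j$ such that $\mathcal{P}=\{(\mathsf{X}^1)_I,\dots,(\mathsf{X}^t)_I\}$ is a subpartition of $\Gamma_j$ and $((\mathsf{X}^s)_O\setminus(\mathsf{X}^s)_I)\cap\Gamma_j=\emptyset$ holds for $s=1,\dots,t$.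
   Context: A mixed graph $F=(V;E,A)$ consists of a finite vertex set $V$, a set $E$ of undirected edges and a set $A$ of directed arcs. A mixed path is a subgraph in which the undirected edges can be oriented so that the resulting directed graph is a directed path. An $r$-mixed arborescence is a subgraph in which for each of its vertices $v$ there is exactly one mixed path from $r$ to $v$; it spans $U$ if its vertex set is $U$. A packing is a collection of mutually edge-disjoint and arc-disjoint mixed arborescences (here one for each $i=1,\dots,k$; the roots need not be distinct). For $u,v\in V$ write $u\sim v$ if $\{i\mid u\in U_i\}=\{i\mid v\in U_i\}$; this is an equivalence relation on $V$, and its equivalence classes $\Gamma_1,\dots,\Gamma_l$ are called atoms. A bi-set is a pair $\mathsf{X}=(\mathsf{X}_O,\mathsf{X}_I)$ with $\mathsf{X}_I\subseteq\mathsf{X}_O\subseteq V$. $\rho_A(\mathsf{X})$ is the number of arcs of $A$ with tail in $V\setminus\mathsf{X}_O$ and head in $\mathsf{X}_I$. A subpartition of a set is a collection of pairwise disjoint nonempty subsets of it (indexed here by $1,\dots,t$). For a subpartition $\mathcal{P}$, $e_E(\mathcal{P})$ is the number of edges of $E$ that have exactly one endpoint in at least one member of $\mathcal{P}$ (that is, edges joining two distinct members of $\mathcal{P}$, or joining a member of $\mathcal{P}$ to a vertex outside all members). -}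

module Defs where

open import Data.Fin using (Fin)
open import Data.Fin.Properties using (any?)
open import Data.Fin.Subset using (Subset; _∈_; _∉_; _⊆_; _∩_; _─_; ⊤; Nonempty; Empty)
open import Data.Fin.Subset.Properties using (_∈?_; _⊆?_; nonempty?; ∈⊤)
open import Data.List using (List; []; _∷_)
open import Data.List.Relation.Unary.Unique.Propositional using (Unique)
open import Data.Nat using (ℕ)
open import Data.Product using (Σ; ∃; ∃!; _×_; _,_; proj₁; proj₂)
open import Data.Sum using (_⊎_)
open import Data.Vec using (allFin; count; sum; tabulate)
open import Function using (_⇔_)
open import Relation.Binary.Construct.Closure.ReflexiveTransitive using (Star; ε; _◅_)
open import Relation.Binary.PropositionalEquality using (_≡_; _≢_)
open import Relation.Nullary.Decidable using (¬?; _×-dec_; _⊎-dec_)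
open import Relation.Unary using (Pred; Decidable)

-- Parallel edges, parallel arcs and loops are allowed.  The pair `ends e`
-- carries no orientation: every use below is symmetric in its components.
record MixedGraph : Set where
  field
    #V #E #A : ℕ
    ends     : Fin #E → Fin #V × Fin #V
    tail     : Fin #A → Fin #V
    head     : Fin #A → Fin #V

  Vertex = Fin #V
  Edge   = Fin #E
  Arc    = Fin #A

record Subgraph (F : MixedGraph) : Set where
  open MixedGraph F
  field
    verts : Subset #V
    edges : Subset #E
    arcs  : Subset #A
    edges-closed : ∀ {e} → e ∈ edges → proj₁ (ends e) ∈ verts × proj₂ (ends e) ∈ verts
    arcs-closed  : ∀ {a} → a ∈ arcs → tail a ∈ verts × head a ∈ verts

whole : (F : MixedGraph) → Subgraph F
whole F = record
  { verts = ⊤ ; edges = ⊤ ; arcs = ⊤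
  ; edges-closed = λ _ → ∈⊤ , ∈⊤
  ; arcs-closed  = λ _ → ∈⊤ , ∈⊤
  }

module _ {F : MixedGraph} (H : Subgraph F) where
  open MixedGraph F
  open Subgraph H

  -- An undirected edge may be traversed in either direction; the direction
  -- of travel is the orientation that turns a mixed path into a directed one.
  data Step (u v : Vertex) : Set where
    arc  : ∀ a → a ∈ arcs → tail a ≡ u → head a ≡ v → Step u v
    edge : ∀ e → e ∈ edges → ends e ≡ (u , v) ⊎ ends e ≡ (v , u) → Step u v

  Walk : Vertex → Vertex → Set
  Walk = Star Step

  visited : ∀ {u v} → Walk u v → List Vertex
  visited {u} ε       = u ∷ []
  visited {u} (_ ◅ w) = u ∷ visited w

  -- No vertex is repeated, so every edge is used at most once and a path from
  -- u to v is determined by, and determines, the subgraph that it traverses.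
  IsMixedPath : ∀ {u v} → Walk u v → Set
  IsMixedPath w = Unique (visited w)

  Reachable : Vertex → Vertex → Set
  Reachable u v = Σ (Walk u v) IsMixedPath

  IsArborescence : Vertex → Set
  IsArborescence r = ∀ v → v ∈ verts → ∃! _≡_ (λ (w : Walk r v) → IsMixedPath w)

module _ (F : MixedGraph) {k : ℕ} where
  open MixedGraph F
  open Subgraph

  IsReachableFamily : (Fin k → Vertex) → (Fin k → Subset #V) → Set
  IsReachableFamily r U = ∀ i v → v ∈ U i ⇔ Reachable (whole F) (r i) v

  record Packing (r : Fin k → Vertex) (U : Fin k → Subset #V) : Set where
    field
      tree           : Fin k → Subgraph F
      arborescence   : ∀ i → IsArborescence (tree i) (r i)
      spanning       : ∀ i → verts (tree i) ≡ U i
      edges-disjoint : ∀ i j → i ≢ j → Empty (edges (tree i) ∩ edges (tree j))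
      arcs-disjoint  : ∀ i j → i ≢ j → Empty (arcs (tree i) ∩ arcs (tree j))

module _ {n k : ℕ} (U : Fin k → Subset n) where

  _∼_ : Fin n → Fin n → Set
  u ∼ v = ∀ i → u ∈ U i ⇔ v ∈ U i

  IsAtom : Subset n → Set
  IsAtom Γ = ∃ λ u → ∀ v → v ∈ Γ ⇔ u ∼ v

record BiSet (n : ℕ) : Set where
  field
    outer inner : Subset n
    inner⊆outer : inner ⊆ outer

  wall : Subset n
  wall = outer ─ inner

open BiSet public

record IsSubpartition {n t : ℕ} (Γ : Subset n) (P : Fin t → Subset n) : Set where
  field
    nonempty : ∀ s → Nonempty (P s)
    within   : ∀ s → P s ⊆ Γ
    disjoint : ∀ s s′ → s ≢ s′ → Empty (P s ∩ P s′)

#_ : ∀ {n p} {P : Pred (Fin n) p} → Decidable P → ℕ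
# P? = count P? (allFin _)

∑ : ∀ {t} → (Fin t → ℕ) → ℕ
∑ f = sum (tabulate f)

module _ (F : MixedGraph) where
  open MixedGraph F

  Enters : BiSet #V → Arc → Set
  Enters X a = tail a ∉ outer X × head a ∈ inner X

  enters? : ∀ X → Decidable (Enters X)
  enters? X a = ¬? (tail a ∈? outer X) ×-dec (head a ∈? inner X)

  ρ : BiSet #V → ℕ
  ρ X = # enters? X

  ExactlyOneEnd : Subset #V → Edge → Set
  ExactlyOneEnd Q e = let (u , v) = ends e in (u ∈ Q × v ∉ Q) ⊎ (u ∉ Q × v ∈ Q)

  exactlyOneEnd? : ∀ Q → Decidable (ExactlyOneEnd Q)
  exactlyOneEnd? Q e = let (u , v) = ends e in
    ((u ∈? Q) ×-dec ¬? (v ∈? Q)) ⊎-dec (¬? (u ∈? Q) ×-dec (v ∈? Q))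

  Crosses : ∀ {t} → (Fin t → Subset #V) → Edge → Set
  Crosses P e = ∃ λ s → ExactlyOneEnd (P s) e

  crosses? : ∀ {t} (P : Fin t → Subset #V) → Decidable (Crosses P)
  crosses? P e = any? (λ s → exactlyOneEnd? (P s) e)

  eE : ∀ {t} → (Fin t → Subset #V) → ℕ
  eE P = # crosses? P

module _ {n k : ℕ} (r : Fin k → Fin n) (U : Fin k → Subset n) (X : BiSet n) where

  Demands : Fin k → Set
  Demands i = inner X ⊆ U i × r i ∉ inner X × Empty (wall X ∩ U i)

  demands? : Decidable Demands
  demands? i = (inner X ⊆? U i) ×-dec ¬? (r i ∈? inner X) ×-dec ¬? (nonempty? (wall X ∩ U i))

  demand : ℕ
  demand = # demands?

{-# OPTIONS --safe #-}

-- Necessity: in a packing, each tree i demanded at X s enters the inner set of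
-- X s by an arc entering X s or by a crossing edge; a tree uses an edge in one
-- direction only, so no edge is counted twice.
--
-- Sufficiency: both ends of an edge lie in the same atom, and an arc never
-- leaves U i.  Uncrossing two violated families inside one atom shows
-- that the edges can be oriented one at a time so that the subpartition
-- condition survives; once every edge is an arc, single bi-sets suffice.  The directed
-- problem is then solved as in Lovász's proof of Edmonds' theorem: grow all
-- the trees arc by arc, keeping the number of unused arcs that enter each
-- bi-set at least the number of trees that still have to enter it.
module Submission where

open import Defs
open import Data.Bool using (Bool; true; false; if_then_else_)
open import Data.Empty using (⊥-elim)
open import Data.Fin using (Fin; zero; suc; _≟_; _↑ˡ_; _↑ʳ_; splitAt)
open import Data.Fin.Properties
  using (all?; any?; ¬∀⟶∃¬; splitAt-↑ˡ; splitAt-↑ʳ; splitAt⁻¹-↑ˡ; splitAt⁻¹-↑ʳ; ↑ˡ-injective; ↑ʳ-injective)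
open import Data.Fin.Subset
  using (Subset; inside; outside; _∈_; _∉_; _⊆_; _∩_; _∪_; _─_; ⊤; ⊥; Nonempty; Empty; ∣_∣)
open import Data.Fin.Subset.Properties
  using (_∈?_; nonempty?; anySubset?; ∈⊤; ∉⊥; p∩q⊆p; p∩q⊆q; p─q⊆p; x∈p∩q⁺; x∈p∪q⁺; x∈p∪q⁻; ⊆-antisym;
         x∈p∧x∉q⇒x∈p─q; p⊂q⇒∣p∣<∣q∣)
open import Data.List using (List; []; _∷_; _++_; length)
import Data.List.Membership.DecPropositional as DecMembership
open import Data.List.Membership.Propositional using () renaming (_∈_ to _∈ᴸ_)
open import Data.List.Membership.Propositional.Properties using (∈-++⁺ʳ; ∈-++⁻)
open import Data.List.Properties using (++-assoc; ++-identityʳ; length-++)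
open import Data.List.Relation.Unary.All as All using ([]; _∷_)
open import Data.List.Relation.Unary.All.Properties using (++⁻ˡ; ¬Any⇒All¬)
open import Data.List.Relation.Unary.AllPairs using ([]; _∷_)
open import Data.List.Relation.Unary.Any using (here; there)
open import Data.List.Relation.Unary.Unique.Propositional using (Unique)
open import Data.List.Relation.Unary.Unique.Propositional.Properties using (++⁺)
open import Data.Maybe using (Maybe; just; nothing)
open import Data.Maybe.Properties using (just-injective) renaming (≡-dec to Maybe-≡-dec)
open import Data.Nat using (ℕ; zero; suc; _+_; _≤_; _<_; _≥_; z≤n; s≤s)
open import Data.Nat.Induction using (<-wellFounded)
open import Data.Nat.Properties hiding (_≟_; suc-injective; ≡-irrelevant)
open import Data.Nat.Tactic.RingSolver using (solve-∀)
open import Data.Product using (Σ; ∃; ∃!; _×_; _,_; proj₁; proj₂)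
open import Data.Sum using (_⊎_; inj₁; inj₂; [_,_]′) renaming (map to ⊎-map)
open import Data.Sum.Properties using () renaming (≡-dec to ⊎-≡-dec)
open import Data.Vec using (Vec; []; _∷_; here; there; count; lookup; map; replicate; tabulate; _[_]≔_)
open import Data.Vec.Properties
  using (lookup∘update; lookup∘update′; lookup∘tabulate; lookup-map; lookup-replicate; lookup⇒[]=; []=⇒lookup)
open import Data.Vec.Properties.WithK using ([]=-irrelevant)
open import Function using (_∘_; id; case_of_; Equivalence; _⇔_; mk⇔)
open import Induction.WellFounded using (Acc; acc)
open import Level using (0ℓ)
open import Relation.Binary.Construct.Closure.ReflexiveTransitive using (ε; _◅_; _◅◅_)
open import Relation.Binary.Construct.Closure.ReflexiveTransitive.Properties using (◅◅-assoc)
open import Relation.Binary.PropositionalEquality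
open import Relation.Binary.PropositionalEquality.WithK using (≡-irrelevant)
open import Relation.Nullary using (Dec; yes; no; does; ¬_; contradiction)
open import Relation.Nullary.Decidable
  using (¬?; _×-dec_; _→-dec_; _⊎-dec_; ⊥-dec; dec-true; dec-false; decidable-stable)
open import Relation.Unary using (Pred; Decidable)

-- Sums of indicators

-- Why bi-sets: `ρ` does not count an arc from the wall to the inner set, so tree `i` may be
-- demanded only if the wall avoids `U i`. Then an arc that brings the tree into the inner set must
-- start outside the outer set. Why families: an undirected edge between two members can serve only
-- one of them, so single bi-sets would overestimate what the edges offer. An arc serves only the
-- member that holds its head, so in a digraph the inequalities of disjoint members simply add up.
-- The obstacle to uncrossing families is the term `eE`: merging two members turns the edges between
-- them from crossing into inner ones. The proof therefore remembers a family only through its union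
-- and two totals, and moves the inner edges to the side of the demand, where they are supermodular.

𝟙 : ∀ {p} {P : Set p} → Dec P → ℕ
𝟙 P? = if does P? then 1 else 0

𝟙-mono : ∀ {p q} {P : Set p} {Q : Set q} (P? : Dec P) (Q? : Dec Q) → (P → Q) → 𝟙 P? ≤ 𝟙 Q?
𝟙-mono (no _)  _       _ = z≤n
𝟙-mono (yes p) (yes _) _ = ≤-refl
𝟙-mono (yes p) (no ¬q) f = contradiction (f p) ¬q

𝟙-yes : ∀ {p} {P : Set p} (P? : Dec P) → P → 𝟙 P? ≡ 1
𝟙-yes P? p = cong (if_then 1 else 0) (dec-true P? p)

𝟙-no : ∀ {p} {P : Set p} (P? : Dec P) → ¬ P → 𝟙 P? ≡ 0
𝟙-no P? ¬p = cong (if_then 1 else 0) (dec-false P? ¬p)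

𝟙-< : ∀ {p q} {P : Set p} {Q : Set q} (P? : Dec P) (Q? : Dec Q) → 𝟙 P? < 𝟙 Q? → ¬ P × Q
𝟙-< (no ¬p) (yes q) _         = ¬p , q
𝟙-< (yes _) (yes _) (s≤s ())

-- The source of every sub- and supermodular inequality below: all counts are sums of indicators, so
-- uncrossing becomes a case analysis at one arc, edge or colour.
𝟙-exchange : ∀ {a b c d} {A : Set a} {B : Set b} {C : Set c} {D : Set d}
  (A? : Dec A) (B? : Dec B) (C? : Dec C) (D? : Dec D) →
  (A → C ⊎ D) → (B → C ⊎ D) → (A → B → C × D) → 𝟙 A? + 𝟙 B? ≤ 𝟙 C? + 𝟙 D?
𝟙-exchange (no _)  (no _)  _       _       _ _ _ = z≤n
𝟙-exchange (no _)  (yes b) (yes _) _       _ _ _ = s≤s z≤n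
𝟙-exchange (no _)  (yes b) (no _)  (yes _) _ _ _ = s≤s z≤n
𝟙-exchange (no _)  (yes b) (no ¬c) (no ¬d) _ g _ = ⊥-elim ([ ¬c , ¬d ]′ (g b))
𝟙-exchange (yes a) (no _)  (yes _) _       _ _ _ = s≤s z≤n
𝟙-exchange (yes a) (no _)  (no _)  (yes _) _ _ _ = s≤s z≤n
𝟙-exchange (yes a) (no _)  (no ¬c) (no ¬d) f _ _ = ⊥-elim ([ ¬c , ¬d ]′ (f a))
𝟙-exchange (yes a) (yes b) C? D? _ _ h =
  ≤-reflexive (sym (cong₂ _+_ (𝟙-yes C? (proj₁ (h a b))) (𝟙-yes D? (proj₂ (h a b)))))

∑-cong : ∀ {n} {f g : Fin n → ℕ} → (∀ i → f i ≡ g i) → ∑ f ≡ ∑ g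
∑-cong {zero}  _   = refl
∑-cong {suc n} f≡g = cong₂ _+_ (f≡g zero) (∑-cong (f≡g ∘ suc))

∑-mono : ∀ {n} {f g : Fin n → ℕ} → (∀ i → f i ≤ g i) → ∑ f ≤ ∑ g
∑-mono {zero}  _   = z≤n
∑-mono {suc n} f≤g = +-mono-≤ (f≤g zero) (∑-mono (f≤g ∘ suc))

∑-mono-< : ∀ {n} {f g : Fin n → ℕ} → (∀ i → f i ≤ g i) → ∀ i → f i < g i → ∑ f < ∑ g
∑-mono-< f≤g zero    f<g = +-mono-<-≤ f<g (∑-mono (f≤g ∘ suc))
∑-mono-< f≤g (suc i) f<g = +-mono-≤-< (f≤g zero) (∑-mono-< (f≤g ∘ suc) i f<g)

-- The slack of one pays for the single arc being coloured or the single edge being oriented.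
∑-mono-except : ∀ {n} {f g : Fin n → ℕ} i → f i ≤ suc (g i) → (∀ j → j ≢ i → f j ≤ g j) →
                ∑ f ≤ suc (∑ g)
∑-mono-except zero    fi≤ f≤g = +-mono-≤ fi≤ (∑-mono (λ j → f≤g (suc j) λ ()))
∑-mono-except {f = f} {g} (suc i) fi≤ f≤g = begin
  f zero + ∑ (f ∘ suc)       ≤⟨ +-mono-≤ (f≤g zero λ ()) (∑-mono-except i fi≤ λ j j≢i → f≤g (suc j) λ { refl → j≢i refl }) ⟩
  g zero + suc (∑ (g ∘ suc)) ≡⟨ +-suc (g zero) _ ⟩
  suc (∑ g)                  ∎
  where open ≤-Reasoning

≤-∑ : ∀ {n} (f : Fin n → ℕ) i → f i ≤ ∑ f
≤-∑ f zero    = m≤m+n _ _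
≤-∑ f (suc i) = ≤-trans (≤-∑ (f ∘ suc) i) (m≤n+m _ _)

∑-<-witness : ∀ {n} {f g : Fin n → ℕ} → ∑ f < ∑ g → ∃ λ i → f i < g i
∑-<-witness {suc n} {f} {g} ∑f<∑g with f zero <? g zero
... | yes f<g = zero , f<g
... | no  f≮g with ∑ (f ∘ suc) <? ∑ (g ∘ suc)
...   | yes lt = let i , f<g = ∑-<-witness lt in suc i , f<g
...   | no  nl = contradiction (+-mono-≤ (≮⇒≥ f≮g) (≮⇒≥ nl)) (<⇒≱ ∑f<∑g)

+-interchange : ∀ a b c d → (a + b) + (c + d) ≡ (a + c) + (b + d)
+-interchange = solve-∀

∑-+ : ∀ {n} (f g : Fin n → ℕ) → ∑ (λ i → f i + g i) ≡ ∑ f + ∑ g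
∑-+ {zero}  f g = refl
∑-+ {suc n} f g = begin
  f zero + g zero + ∑ (λ i → f (suc i) + g (suc i)) ≡⟨ cong (f zero + g zero +_) (∑-+ (f ∘ suc) (g ∘ suc)) ⟩
  f zero + g zero + (∑ (f ∘ suc) + ∑ (g ∘ suc))     ≡⟨ +-interchange (f zero) (g zero) _ _ ⟩
  ∑ f + ∑ g                                         ∎
  where open ≡-Reasoning

∑-zero : ∀ {n} → ∑ {n} (λ _ → 0) ≡ 0
∑-zero {zero}  = refl
∑-zero {suc n} = ∑-zero {n}

∑-swap : ∀ {m n} (f : Fin m → Fin n → ℕ) → ∑ (λ i → ∑ (f i)) ≡ ∑ (λ j → ∑ (λ i → f i j))
∑-swap {zero}  {n} f = sym (∑-zero {n})
∑-swap {suc m}     f = begin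
  ∑ (f zero) + ∑ (λ i → ∑ (f (suc i)))           ≡⟨ cong (∑ (f zero) +_) (∑-swap (f ∘ suc)) ⟩
  ∑ (f zero) + ∑ (λ j → ∑ (λ i → f (suc i) j))   ≡⟨ ∑-+ (f zero) _ ⟨
  ∑ (λ j → ∑ (λ i → f i j))                      ∎
  where open ≡-Reasoning

∑-splitAt : ∀ m {n} (f : Fin (m + n) → ℕ) → ∑ f ≡ ∑ (λ i → f (i ↑ˡ n)) + ∑ (λ j → f (m ↑ʳ j))
∑-splitAt zero    f = refl
∑-splitAt (suc m) f = trans (cong (f zero +_) (∑-splitAt m (f ∘ suc))) (sym (+-assoc (f zero) _ _))

∑-exchange : ∀ {n} (f g h k : Fin n → ℕ) → (∀ i → f i + g i ≤ h i + k i) → ∑ f + ∑ g ≤ ∑ h + ∑ k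
∑-exchange f g h k le = begin
  ∑ f + ∑ g             ≡⟨ ∑-+ f g ⟨
  ∑ (λ i → f i + g i)   ≤⟨ ∑-mono le ⟩
  ∑ (λ i → h i + k i)   ≡⟨ ∑-+ h k ⟩
  ∑ h + ∑ k             ∎
  where open ≤-Reasoning

∑-at-most-one : ∀ {n c p} {P : Pred (Fin n) p} {C : Set c} (P? : Decidable P) (C? : Dec C) →
  (∀ i → P i → C) → (∀ i j → P i → P j → i ≡ j) → ∑ (𝟙 ∘ P?) ≤ 𝟙 C?
∑-at-most-one {zero}  P? C? imp uniq = z≤n
∑-at-most-one {suc n} P? C? imp uniq with P? zero
... | no  _ = ∑-at-most-one (P? ∘ suc) C? (imp ∘ suc) λ i j p q → case uniq _ _ p q of λ { refl → refl }
... | yes p = begin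
  suc (∑ (𝟙 ∘ P? ∘ suc))  ≡⟨ cong suc (∑-cong λ i → 𝟙-no (P? (suc i)) λ q → case uniq _ _ p q of λ ()) ⟩
  suc (∑ {n} (λ _ → 0))   ≡⟨ cong suc (∑-zero {n}) ⟩
  1                       ≡⟨ 𝟙-yes C? (imp zero p) ⟨
  𝟙 C?                    ∎
  where open ≤-Reasoning

count-tabulate : ∀ {a p n} {A : Set a} {P : Pred A p} (P? : Decidable P) (g : Fin n → A) →
                 count P? (tabulate g) ≡ ∑ (λ i → 𝟙 (P? (g i)))
count-tabulate {n = zero}  P? g = refl
count-tabulate {n = suc n} P? g with does (P? (g zero))
... | true  = cong suc (count-tabulate P? (g ∘ suc))
... | false = count-tabulate P? (g ∘ suc)

#≡∑ : ∀ {n p} {P : Pred (Fin n) p} (P? : Decidable P) → # P? ≡ ∑ (λ i → 𝟙 (P? i))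
#≡∑ P? = count-tabulate P? id

-- Bi-sets relative to a vertex set, and uncrossing of families

∈∩⁺ : ∀ {n x} {p q : Subset n} → x ∈ p → x ∈ q → x ∈ p ∩ q
∈∩⁺ x∈p x∈q = x∈p∩q⁺ (x∈p , x∈q)

∈∩ˡ : ∀ {n x} {p q : Subset n} → x ∈ p ∩ q → x ∈ p
∈∩ˡ {p = p} {q} = p∩q⊆p p q

∈∩ʳ : ∀ {n x} {p q : Subset n} → x ∈ p ∩ q → x ∈ q
∈∩ʳ {p = p} {q} = p∩q⊆q p q

∈∪⁻ : ∀ {n x} {p q : Subset n} → x ∈ p ∪ q → x ∈ p ⊎ x ∈ q
∈∪⁻ = x∈p∪q⁻ _ _

∈∪ˡ : ∀ {n x} {p q : Subset n} → x ∈ p → x ∈ p ∪ q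
∈∪ˡ = x∈p∪q⁺ ∘ inj₁

∈∪ʳ : ∀ {n x} {p q : Subset n} → x ∈ q → x ∈ p ∪ q
∈∪ʳ = x∈p∪q⁺ ∘ inj₂

-- A bi-set X with inner set inside Γ and wall outside Γ is determined by its
-- outer set O: the inner set is O ∩ Γ.  On outer sets, the lattice operations
-- of bi-sets are ∩ and ∪.
trace : ∀ {n} → Subset n → Subset n → BiSet n
trace Γ O = record { outer = O ; inner = O ∩ Γ ; inner⊆outer = p∩q⊆p O Γ }

leads-into? : ∀ {n} (Γ : Subset n) (u v : Fin n) → Decidable (λ O → u ∉ O × v ∈ O ∩ Γ)
leads-into? Γ u v O = ¬? (u ∈? O) ×-dec (v ∈? (O ∩ Γ))

-- An arc entering the meet has its head in both sets and its tail outside one of them; an arc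
-- entering the join has its tail outside both and its head in one.
leads-into-exchange : ∀ {n} (Γ O O′ : Subset n) (u v : Fin n) →
  𝟙 (leads-into? Γ u v (O ∩ O′)) + 𝟙 (leads-into? Γ u v (O ∪ O′))
    ≤ 𝟙 (leads-into? Γ u v O) + 𝟙 (leads-into? Γ u v O′)
leads-into-exchange Γ O O′ u v = 𝟙-exchange
  (leads-into? Γ u v (O ∩ O′)) (leads-into? Γ u v (O ∪ O′)) (leads-into? Γ u v O) (leads-into? Γ u v O′)
  meet join λ { (_ , v∈) (u∉ , _) → (u∉ ∘ ∈∪ˡ , ∈∩⁺ (∈∩ˡ (∈∩ˡ v∈)) (∈∩ʳ v∈)) ,
                                    (u∉ ∘ ∈∪ʳ , ∈∩⁺ (∈∩ʳ (∈∩ˡ v∈)) (∈∩ʳ v∈)) }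
  where
  meet : (u ∉ O ∩ O′ × v ∈ (O ∩ O′) ∩ Γ) → (u ∉ O × v ∈ O ∩ Γ) ⊎ (u ∉ O′ × v ∈ O′ ∩ Γ)
  meet (u∉ , v∈) with u ∈? O
  ... | no u∉O = inj₁ (u∉O , ∈∩⁺ (∈∩ˡ (∈∩ˡ v∈)) (∈∩ʳ v∈))
  ... | yes u∈O = inj₂ (u∉ ∘ ∈∩⁺ u∈O , ∈∩⁺ (∈∩ʳ (∈∩ˡ v∈)) (∈∩ʳ v∈))
  join : (u ∉ O ∪ O′ × v ∈ (O ∪ O′) ∩ Γ) → (u ∉ O × v ∈ O ∩ Γ) ⊎ (u ∉ O′ × v ∈ O′ ∩ Γ)
  join (u∉ , v∈) with ∈∪⁻ (∈∩ˡ v∈)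
  ... | inj₁ v∈O  = inj₁ (u∉ ∘ ∈∪ˡ , ∈∩⁺ v∈O (∈∩ʳ v∈))
  ... | inj₂ v∈O′ = inj₂ (u∉ ∘ ∈∪ʳ , ∈∩⁺ v∈O′ (∈∩ʳ v∈))

-- R i x says that colour i has already reached x.  For an atom Γ ⊆ U i, colour
-- i is counted in the demand of the bi-set with outer set O when it has reached
-- no vertex of O ∩ Γ and the wall O ─ Γ avoids U i.
module Wanting {n k : ℕ} (U : Fin k → Subset n)
               (R : Fin k → Fin n → Set) (R? : ∀ i x → Dec (R i x)) where

  -- One condition per vertex of `O`, so that it passes at once to subsets and to unions;
  -- supermodularity of `wanted` needs only these two facts.
  Wants : Subset n → Subset n → Fin k → Set
  Wants Γ O i = ∀ x → x ∈ O → (x ∈ Γ → x ∈ U i × ¬ R i x) × (x ∈ U i → x ∈ Γ)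

  wants? : ∀ Γ O → Decidable (Wants Γ O)
  wants? Γ O i = all? λ x → (x ∈? O) →-dec
    (((x ∈? Γ) →-dec ((x ∈? U i) ×-dec ¬? (R? i x))) ×-dec ((x ∈? U i) →-dec (x ∈? Γ)))

  wanted : Subset n → Subset n → ℕ
  wanted Γ O = ∑ (λ i → 𝟙 (wants? Γ O i))

  wants-antitone : ∀ {Γ O O′ i} → O′ ⊆ O → Wants Γ O i → Wants Γ O′ i
  wants-antitone O′⊆O w x = w x ∘ O′⊆O

  wants-∪ : ∀ {Γ O O′ i} → Wants Γ O i → Wants Γ O′ i → Wants Γ (O ∪ O′) i
  wants-∪ w w′ x = [ w x , w′ x ]′ ∘ ∈∪⁻

  wants-exchange : ∀ Γ O O′ i → 𝟙 (wants? Γ O i) + 𝟙 (wants? Γ O′ i)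
                              ≤ 𝟙 (wants? Γ (O ∩ O′) i) + 𝟙 (wants? Γ (O ∪ O′) i)
  wants-exchange Γ O O′ i =
    𝟙-exchange (wants? Γ O i) (wants? Γ O′ i) (wants? Γ (O ∩ O′) i) (wants? Γ (O ∪ O′) i)
      (λ w → inj₁ (wants-antitone {i = i} ∈∩ˡ w)) (λ w → inj₁ (wants-antitone {i = i} ∈∩ʳ w))
      (λ w w′ → wants-antitone {i = i} ∈∩ˡ w , wants-∪ {i = i} w w′)

  wanted-supermodular : ∀ Γ O O′ → wanted Γ O + wanted Γ O′ ≤ wanted Γ (O ∩ O′) + wanted Γ (O ∪ O′)
  wanted-supermodular Γ O O′ = ∑-exchange _ _ (𝟙 ∘ wants? Γ (O ∩ O′)) (𝟙 ∘ wants? Γ (O ∪ O′))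
                                          (wants-exchange Γ O O′)

-- Uncrossing two families of disjoint parts

module Families {n : ℕ} (Γ : Subset n) (gain cost : Subset n → ℕ)
  (supermodular : ∀ O O′ → gain O + gain O′ ≤ gain (O ∩ O′) + gain (O ∪ O′))
  (submodular : ∀ O O′ → cost (O ∩ O′) + cost (O ∪ O′) ≤ cost O + cost O′) where

  -- The indices are the union of the parts O ∩ Γ, their total gain and their total cost.
  data Family : Subset n → ℕ → ℕ → Set where
    []  : Family ⊥ 0 0
    add : ∀ {Z a c} O → Nonempty (O ∩ Γ) → Empty ((O ∩ Γ) ∩ Z) → Family Z a c →
          Family ((O ∩ Γ) ∪ Z) (gain O + a) (cost O + c)

  -- The total gain may only rise and the total cost only fall, so the excess of gain over cost in
  -- the original pair survives in the new one.
  record Uncrossed (Z Z′ : Subset n) (a c : ℕ) : Set where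
    constructor uncrossed
    field
      {a₁ c₁ a₂ c₂} : ℕ
      first   : Family Z a₁ c₁
      second  : Family Z′ a₂ c₂
      gain≤ : a ≤ a₁ + a₂
      cost≥ : c₁ + c₂ ≤ c

  transport : ∀ {Z W a c} → Z ⊆ W → W ⊆ Z → Family Z a c → Family W a c
  transport Z⊆W W⊆Z = subst (λ Z → Family Z _ _) (⊆-antisym Z⊆W W⊆Z)

  append : ∀ {Z W a b c d} → Family Z a c → Family W b d → Empty (Z ∩ W) → Family (Z ∪ W) (a + b) (c + d)
  append [] G _ = transport ∈∪ʳ ([ ⊥-elim ∘ ∉⊥ , id ]′ ∘ ∈∪⁻) G
  append {W = W} {b = b} {d = d} (add {Z} {a} {c} O ne disj F) G Z#W =
    subst₂ (Family _) (sym (+-assoc (gain O) a b)) (sym (+-assoc (cost O) c d))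
      (transport ([ ∈∪ˡ ∘ ∈∪ˡ , [ ∈∪ˡ ∘ ∈∪ʳ , ∈∪ʳ ]′ ∘ ∈∪⁻ ]′ ∘ ∈∪⁻)
                 ([ [ ∈∪ˡ , ∈∪ʳ ∘ ∈∪ˡ ]′ ∘ ∈∪⁻ , ∈∪ʳ ∘ ∈∪ʳ ]′ ∘ ∈∪⁻)
        (add O ne
          (λ { (x , x∈) → case ∈∪⁻ (∈∩ʳ x∈) of λ
               { (inj₁ x∈Z) → disj (x , ∈∩⁺ (∈∩ˡ x∈) x∈Z)
               ; (inj₂ x∈W) → Z#W (x , ∈∩⁺ (∈∪ˡ (∈∩ˡ x∈)) x∈W) } })
          (append F G λ { (x , x∈) → Z#W (x , ∈∩⁺ (∈∪ʳ (∈∩ˡ x∈)) (∈∩ʳ x∈)) })))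

  private
    gain-step : ∀ g h x a b₁ b₂ {i u} → g + h ≤ i + u → a + u ≤ b₁ + b₂ → x ≡ g + a →
                x + h ≤ b₁ + (i + b₂)
    gain-step g h _ a b₁ b₂ {i} {u} le le′ refl = begin
      g + a + h        ≡⟨ shuffle g a h ⟩
      (g + h) + a      ≤⟨ +-monoˡ-≤ a le ⟩
      i + u + a        ≡⟨ shuffle′ i u a ⟩
      i + (a + u)      ≤⟨ +-monoʳ-≤ i le′ ⟩
      i + (b₁ + b₂)    ≡⟨ shuffle″ i b₁ b₂ ⟩
      b₁ + (i + b₂)    ∎
      where
      open ≤-Reasoning
      shuffle : ∀ g a h → g + a + h ≡ (g + h) + a
      shuffle = solve-∀
      shuffle′ : ∀ i u a → i + u + a ≡ i + (a + u)
      shuffle′ = solve-∀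
      shuffle″ : ∀ i b c → i + (b + c) ≡ b + (i + c)
      shuffle″ = solve-∀

    cost-step : ∀ g h x a b₁ b₂ {i u} → i + u ≤ g + h → b₁ + b₂ ≤ a + u → x ≡ g + a →
                b₁ + (i + b₂) ≤ x + h
    cost-step g h _ a b₁ b₂ {i} {u} le le′ refl = begin
      b₁ + (i + b₂)    ≡⟨ shuffle″ i b₁ b₂ ⟩
      i + (b₁ + b₂)    ≤⟨ +-monoʳ-≤ i le′ ⟩
      i + (a + u)      ≡⟨ shuffle′ i u a ⟩
      i + u + a        ≤⟨ +-monoˡ-≤ a le ⟩
      (g + h) + a      ≡⟨ shuffle g a h ⟩
      g + a + h        ∎
      where
      open ≤-Reasoning
      shuffle : ∀ g a h → (g + h) + a ≡ g + a + h
      shuffle = solve-∀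
      shuffle′ : ∀ i u a → i + (a + u) ≡ i + u + a
      shuffle′ = solve-∀
      shuffle″ : ∀ i b c → b + (i + c) ≡ i + (b + c)
      shuffle″ = solve-∀

  -- `O` moves along the family. A part disjoint from it inside `Γ` is kept; a part `X` that meets
  -- it leaves `X ∩ O` to the second family, and `X ∪ O` moves on in place of `O`.
  absorb : ∀ {Z a c} → Family Z a c → ∀ O → Nonempty (O ∩ Γ) →
           Uncrossed (Z ∪ (O ∩ Γ)) (Z ∩ (O ∩ Γ)) (a + gain O) (c + cost O)
  absorb [] O ne = uncrossed
    (transport ([ ∈∪ʳ , ⊥-elim ∘ ∉⊥ ]′ ∘ ∈∪⁻) ([ ⊥-elim ∘ ∉⊥ , ∈∪ˡ ]′ ∘ ∈∪⁻)
      (add O ne (∉⊥ ∘ ∈∩ʳ ∘ proj₂) []))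
    (transport (⊥-elim ∘ ∉⊥) ∈∩ˡ [])
    (≤-reflexive (sym (trans (+-identityʳ _) (+-identityʳ _))))
    (≤-reflexive (trans (+-identityʳ _) (+-identityʳ _)))
  absorb (add {Z} {a} {c} X neX disj F) O ne with nonempty? ((X ∩ O) ∩ Γ)
  ... | no X#O =
    let uncrossed {a₁} {c₁} {a₂} {c₂} F₁ F₂ le ge = absorb F O ne in
    uncrossed
      (transport ([ ∈∪ˡ ∘ ∈∪ˡ , [ ∈∪ˡ ∘ ∈∪ʳ , ∈∪ʳ ]′ ∘ ∈∪⁻ ]′ ∘ ∈∪⁻)
                 ([ [ ∈∪ˡ , ∈∪ʳ ∘ ∈∪ˡ ]′ ∘ ∈∪⁻ , ∈∪ʳ ∘ ∈∪ʳ ]′ ∘ ∈∪⁻)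
        (add X neX
          (λ { (x , x∈) → case ∈∪⁻ (∈∩ʳ x∈) of λ
               { (inj₁ x∈Z) → disj (x , ∈∩⁺ (∈∩ˡ x∈) x∈Z)
               ; (inj₂ x∈O) → X#O (x , ∈∩⁺ (∈∩⁺ (∈∩ˡ (∈∩ˡ x∈)) (∈∩ˡ x∈O)) (∈∩ʳ x∈O)) } })
          F₁))
      (transport (λ x∈ → ∈∩⁺ (∈∪ʳ (∈∩ˡ x∈)) (∈∩ʳ x∈))
                 (λ x∈ → case ∈∪⁻ (∈∩ˡ x∈) of λ
                   { (inj₁ x∈X) → ⊥-elim (X#O (_ , ∈∩⁺ (∈∩⁺ (∈∩ˡ x∈X) (∈∩ˡ (∈∩ʳ x∈))) (∈∩ʳ x∈X)))
                   ; (inj₂ x∈Z) → ∈∩⁺ x∈Z (∈∩ʳ x∈) })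
        F₂)
      (≤-trans (≤-reflexive (+-assoc (gain X) a _))
        (≤-trans (+-monoʳ-≤ (gain X) le) (≤-reflexive (sym (+-assoc (gain X) a₁ a₂)))))
      (≤-trans (≤-reflexive (+-assoc (cost X) c₁ c₂))
        (≤-trans (+-monoʳ-≤ (cost X) ge) (≤-reflexive (sym (+-assoc (cost X) c _)))))
  ... | yes X∩O =
    -- `X` is disjoint from the rest `Z` inside `Γ`, so `X ∪ O` meets `Z` there only where `O` does.
    -- The recursion thus cuts off the rest of the intersection, and `X ∩ O` completes it.
    let uncrossed {a₁} {c₁} {a₂} {c₂} F₁ F₂ le ge =
          absorb F (X ∪ O) (proj₁ ne , ∈∩⁺ (∈∪ʳ (∈∩ˡ (proj₂ ne))) (∈∩ʳ (proj₂ ne))) in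
    uncrossed
      (transport ([ ∈∪ˡ ∘ ∈∪ʳ , (λ x∈ → case ∈∪⁻ (∈∩ˡ x∈) of λ
                       { (inj₁ x∈X) → ∈∪ˡ (∈∪ˡ (∈∩⁺ x∈X (∈∩ʳ x∈)))
                       ; (inj₂ x∈O) → ∈∪ʳ (∈∩⁺ x∈O (∈∩ʳ x∈)) }) ]′ ∘ ∈∪⁻)
                 ([ [ (λ x∈ → ∈∪ʳ (∈∩⁺ (∈∪ˡ (∈∩ˡ x∈)) (∈∩ʳ x∈))) , ∈∪ˡ ]′ ∘ ∈∪⁻
                  , (λ x∈ → ∈∪ʳ (∈∩⁺ (∈∪ʳ (∈∩ˡ x∈)) (∈∩ʳ x∈))) ]′ ∘ ∈∪⁻)
        F₁)
      (transport ([ (λ x∈ → ∈∩⁺ (∈∪ˡ (∈∩⁺ (∈∩ˡ (∈∩ˡ x∈)) (∈∩ʳ x∈))) (∈∩⁺ (∈∩ʳ (∈∩ˡ x∈)) (∈∩ʳ x∈)))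
                  , (λ x∈ → ∈∩⁺ (∈∪ʳ (∈∩ˡ x∈)) (case ∈∪⁻ (∈∩ˡ (∈∩ʳ x∈)) of λ
                       { (inj₁ x∈X) → ⊥-elim (disj (_ , ∈∩⁺ (∈∩⁺ x∈X (∈∩ʳ (∈∩ʳ x∈))) (∈∩ˡ x∈)))
                       ; (inj₂ x∈O) → ∈∩⁺ x∈O (∈∩ʳ (∈∩ʳ x∈)) })) ]′ ∘ ∈∪⁻)
                 (λ x∈ → case ∈∪⁻ (∈∩ˡ x∈) of λ
                   { (inj₁ x∈X) → ∈∪ˡ (∈∩⁺ (∈∩⁺ (∈∩ˡ x∈X) (∈∩ˡ (∈∩ʳ x∈))) (∈∩ʳ x∈X))
                   ; (inj₂ x∈Z) → ∈∪ʳ (∈∩⁺ x∈Z (∈∩⁺ (∈∪ʳ (∈∩ˡ (∈∩ʳ x∈))) (∈∩ʳ (∈∩ʳ x∈)))) })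
        (add (X ∩ O) X∩O
          (λ { (x , x∈) → disj (x , ∈∩⁺ (∈∩⁺ (∈∩ˡ (∈∩ˡ (∈∩ˡ x∈))) (∈∩ʳ (∈∩ˡ x∈))) (∈∩ˡ (∈∩ʳ x∈))) })
          F₂))
      (gain-step (gain X) (gain O) _ a a₁ a₂ (supermodular X O) le refl)
      (cost-step (cost X) (cost O) _ c c₁ c₂ (submodular X O) ge refl)

  -- The parts of the second family are absorbed one at a time. They are disjoint, so the pieces
  -- they cut off are disjoint too and can be appended to a single family for the intersection.
  uncross : ∀ {Z W a b c d} → Family Z a c → Family W b d → Uncrossed (Z ∪ W) (Z ∩ W) (a + b) (c + d)
  uncross F [] = uncrossed (transport ∈∪ˡ ([ id , ⊥-elim ∘ ∉⊥ ]′ ∘ ∈∪⁻) F)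
                           (transport (⊥-elim ∘ ∉⊥) ∈∩ʳ []) ≤-refl ≤-refl
  uncross {Z} {a = a} {c = c} F (add {W} {b} {d} O ne disj G) =
    let uncrossed {a₁} {c₁} {a₂} {c₂} F₁ F₂ le ge = absorb F O ne
        uncrossed {b₁} {d₁} {b₂} {d₂} G₁ G₂ le′ ge′ = uncross F₁ G in
    uncrossed
      (transport ([ [ ∈∪ˡ , ∈∪ʳ ∘ ∈∪ˡ ]′ ∘ ∈∪⁻ , ∈∪ʳ ∘ ∈∪ʳ ]′ ∘ ∈∪⁻)
                 ([ ∈∪ˡ ∘ ∈∪ˡ , [ ∈∪ˡ ∘ ∈∪ʳ , ∈∪ʳ ]′ ∘ ∈∪⁻ ]′ ∘ ∈∪⁻) G₁)
      (transport ([ (λ x∈ → ∈∩⁺ (∈∩ˡ x∈) (∈∪ˡ (∈∩ʳ x∈))) , (λ x∈ → case ∈∪⁻ (∈∩ˡ x∈) of λ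
                      { (inj₁ x∈Z) → ∈∩⁺ x∈Z (∈∪ʳ (∈∩ʳ x∈))
                      ; (inj₂ x∈O) → ⊥-elim (disj (_ , ∈∩⁺ x∈O (∈∩ʳ x∈))) }) ]′ ∘ ∈∪⁻)
                 (λ x∈ → case ∈∪⁻ (∈∩ʳ x∈) of λ
                    { (inj₁ x∈O) → ∈∪ˡ (∈∩⁺ (∈∩ˡ x∈) x∈O)
                    ; (inj₂ x∈W) → ∈∪ʳ (∈∩⁺ (∈∪ˡ (∈∩ˡ x∈)) x∈W) })
        (append F₂ G₂ λ { (x , x∈) → disj (x , ∈∩⁺ (∈∩ʳ (∈∩ˡ x∈)) (∈∩ʳ (∈∩ʳ x∈))) }))
      (gain≤-trans a (gain O) b b₁ b₂ le le′)
      (cost≥-trans c (cost O) d d₁ d₂ ge ge′)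
    where
    open ≤-Reasoning
    gain≤-trans : ∀ a g b b₁ b₂ {a₁ a₂} → a + g ≤ a₁ + a₂ → a₁ + b ≤ b₁ + b₂ →
                  a + (g + b) ≤ b₁ + (a₂ + b₂)
    gain≤-trans a g b b₁ b₂ {a₁} {a₂} le le′ = begin
      a + (g + b)      ≡⟨ +-assoc a g b ⟨
      a + g + b        ≤⟨ +-monoˡ-≤ b le ⟩
      a₁ + a₂ + b      ≡⟨ l₁ a₁ a₂ b ⟩
      a₂ + (a₁ + b)    ≤⟨ +-monoʳ-≤ a₂ le′ ⟩
      a₂ + (b₁ + b₂)   ≡⟨ l₂ a₂ b₁ b₂ ⟩
      b₁ + (a₂ + b₂)   ∎
      where
      l₁ : ∀ x y z → x + y + z ≡ y + (x + z)
      l₁ = solve-∀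
      l₂ : ∀ x y z → x + (y + z) ≡ y + (x + z)
      l₂ = solve-∀
    cost≥-trans : ∀ a g b b₁ b₂ {a₁ a₂} → a₁ + a₂ ≤ a + g → b₁ + b₂ ≤ a₁ + b →
                  b₁ + (a₂ + b₂) ≤ a + (g + b)
    cost≥-trans a g b b₁ b₂ {a₁} {a₂} le le′ = begin
      b₁ + (a₂ + b₂)   ≡⟨ l₂ b₁ a₂ b₂ ⟩
      a₂ + (b₁ + b₂)   ≤⟨ +-monoʳ-≤ a₂ le′ ⟩
      a₂ + (a₁ + b)    ≡⟨ l₁ a₂ a₁ b ⟩
      a₁ + a₂ + b      ≤⟨ +-monoˡ-≤ b le ⟩
      a + g + b        ≡⟨ +-assoc a g b ⟩
      a + (g + b)      ∎
      where
      l₁ : ∀ y x z → y + (x + z) ≡ x + y + z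
      l₁ = solve-∀
      l₂ : ∀ y x z → y + (x + z) ≡ x + (y + z)
      l₂ = solve-∀

  record Indexed (Z : Subset n) (a c : ℕ) : Set where
    field
      size      : ℕ
      part      : Fin size → Subset n
      nonempty  : ∀ s → Nonempty (part s ∩ Γ)
      within    : ∀ s → part s ∩ Γ ⊆ Z
      disjoint  : ∀ s s′ → s ≢ s′ → Empty ((part s ∩ Γ) ∩ (part s′ ∩ Γ))
      gain-sum  : a ≡ ∑ (gain ∘ part)
      cost-sum  : c ≡ ∑ (cost ∘ part)

  -- Inductive families suit the recursion of uncrossing, while the condition of the theorem speaks
  -- of indexed ones.
  indexed : ∀ {Z a c} → Family Z a c → Indexed Z a c
  indexed [] = record
    { size = 0 ; part = λ () ; nonempty = λ () ; within = λ () ; disjoint = λ ()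
    ; gain-sum = refl ; cost-sum = refl }
  indexed (add {Z} O ne disj F) = record
    { size = suc size
    ; part = λ { zero → O ; (suc s) → part s }
    ; nonempty = λ { zero → ne ; (suc s) → nonempty s }
    ; within = λ { zero → ∈∪ˡ ; (suc s) → ∈∪ʳ ∘ within s }
    ; disjoint = λ { zero zero 0≢0 → ⊥-elim (0≢0 refl)
                   ; zero (suc s) _ (x , x∈) → disj (x , ∈∩⁺ (∈∩ˡ x∈) (within s (∈∩ʳ x∈)))
                   ; (suc s) zero _ (x , x∈) → disj (x , ∈∩⁺ (∈∩ʳ x∈) (within s (∈∩ˡ x∈)))
                   ; (suc s) (suc s′) s≢s′ → disjoint s s′ (s≢s′ ∘ cong suc) }
    ; gain-sum = cong (gain O +_) gain-sum
    ; cost-sum = cong (cost O +_) cost-sum }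
    where open Indexed (indexed F)

-- Packing in digraphs

⟪_⟫ : ∀ {n p} {P : Pred (Fin n) p} → Decidable P → Subset n
⟪ P? ⟫ = tabulate (does ∘ P?)

∈⟪⟫⁺ : ∀ {n p x} {P : Pred (Fin n) p} (P? : Decidable P) → P x → x ∈ ⟪ P? ⟫
∈⟪⟫⁺ {x = x} P? p = lookup⇒[]= x _ (trans (lookup∘tabulate _ x) (dec-true (P? x) p))

∈⟪⟫⁻ : ∀ {n p x} {P : Pred (Fin n) p} (P? : Decidable P) → x ∈ ⟪ P? ⟫ → P x
∈⟪⟫⁻ {x = x} P? x∈ with P? x | trans (sym (lookup∘tabulate (does ∘ P?) x)) ([]=⇒lookup x∈)
... | yes p | _  = p
... | no _  | ()

-- Atoms as equivalence classes

module Atoms {n k : ℕ} (U : Fin k → Subset n) where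

  open Equivalence

  atom-∼ : ∀ {Γ u v} → IsAtom U Γ → u ∈ Γ → v ∈ Γ → ∀ i → u ∈ U i → v ∈ U i
  atom-∼ {u = u} {v} (x , Γ⇔) u∈Γ v∈Γ i = to (to (Γ⇔ v) v∈Γ i) ∘ from (to (Γ⇔ u) u∈Γ i)

  atom-closed : ∀ {Γ u v} → IsAtom U Γ → u ∈ Γ → (∀ i → u ∈ U i ⇔ v ∈ U i) → v ∈ Γ
  atom-closed {u = u} {v} (x , Γ⇔) u∈Γ u∼v = from (Γ⇔ v) λ i →
    mk⇔ (to (u∼v i) ∘ to (to (Γ⇔ u) u∈Γ i)) (from (to (Γ⇔ u) u∈Γ i) ∘ from (u∼v i))

  atom-unique : ∀ {Γ Γ′ x} → IsAtom U Γ → IsAtom U Γ′ → x ∈ Γ → x ∈ Γ′ → Γ ≡ Γ′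
  atom-unique at at′ x∈Γ x∈Γ′ = ⊆-antisym
    (λ y∈Γ  → atom-closed at′ x∈Γ′ (λ i → mk⇔ (atom-∼ at x∈Γ y∈Γ i) (atom-∼ at y∈Γ x∈Γ i)))
    (λ y∈Γ′ → atom-closed at x∈Γ (λ i → mk⇔ (atom-∼ at′ x∈Γ′ y∈Γ′ i) (atom-∼ at′ y∈Γ′ x∈Γ′ i)))

  ∼? : ∀ x → Decidable (λ y → ∀ i → (x ∈ U i → y ∈ U i) × (y ∈ U i → x ∈ U i))
  ∼? x y = all? λ i → ((x ∈? U i) →-dec (y ∈? U i)) ×-dec ((y ∈? U i) →-dec (x ∈? U i))

  atom : Fin n → Subset n
  atom x = ⟪ ∼? x ⟫

  ∈atom : ∀ x → x ∈ atom x
  ∈atom x = ∈⟪⟫⁺ (∼? x) λ i → id , id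

  atom-isAtom : ∀ x → IsAtom U (atom x)
  atom-isAtom x = x , λ y → mk⇔ (λ y∈ i → mk⇔ (proj₁ (∈⟪⟫⁻ (∼? x) y∈ i)) (proj₂ (∈⟪⟫⁻ (∼? x) y∈ i)))
                                 (λ x∼y → ∈⟪⟫⁺ (∼? x) λ i → to (x∼y i) , from (x∼y i))

  -- Naming atoms by vertices makes quantification over all atoms finite, hence decidable.
  isAtom-atom : ∀ {Γ x} → IsAtom U Γ → x ∈ Γ → Γ ≡ atom x
  isAtom-atom {x = x} at x∈Γ = atom-unique at (atom-isAtom x) x∈Γ (∈atom x)

-- Colouring arcs so that each colour grows one tree

module Growing {n k m : ℕ} (U : Fin k → Subset n) (r : Fin k → Fin n) (r∈U : ∀ i → r i ∈ U i)
               (t h : Fin m → Fin n) (closed : ∀ a i → t a ∈ U i → h a ∈ U i) where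

  open Atoms U

  Colouring : Set
  Colouring = Vec (Maybe (Fin k)) m

  Coloured : Colouring → Fin k → Fin m → Set
  Coloured col i a = lookup col a ≡ just i

  Free : Colouring → Fin m → Set
  Free col a = lookup col a ≡ nothing

  Reached : Colouring → Fin k → Fin n → Set
  Reached col i x = r i ≡ x ⊎ ∃ λ a → Coloured col i a × h a ≡ x

  free? : ∀ col → Decidable (Free col)
  free? col a = Maybe-≡-dec _≟_ (lookup col a) nothing

  reached? : ∀ col i x → Dec (Reached col i x)
  reached? col i x = (r i ≟ x) ⊎-dec any? λ a → Maybe-≡-dec _≟_ (lookup col a) (just i) ×-dec (h a ≟ x)

  module W (col : Colouring) = Wanting U (Reached col) (reached? col)
  open W

  spare? : ∀ col Γ O → Decidable (λ a → Free col a × t a ∉ O × h a ∈ O ∩ Γ)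
  spare? col Γ O a = free? col a ×-dec leads-into? Γ (t a) (h a) O

  spare : Colouring → Subset n → Subset n → ℕ
  spare col Γ O = ∑ (λ a → 𝟙 (spare? col Γ O a))

  Covered : Colouring → Set
  Covered col = ∀ Γ → IsAtom U Γ → ∀ O → Nonempty (O ∩ Γ) → wanted col Γ O ≤ spare col Γ O

  spare-submodular : ∀ col Γ O O′ → spare col Γ (O ∩ O′) + spare col Γ (O ∪ O′)
                                    ≤ spare col Γ O + spare col Γ O′
  spare-submodular col Γ O O′ = ∑-exchange _ _ (𝟙 ∘ spare? col Γ O) (𝟙 ∘ spare? col Γ O′) pointwise
    where
    pointwise : ∀ a → 𝟙 (spare? col Γ (O ∩ O′) a) + 𝟙 (spare? col Γ (O ∪ O′) a)
                      ≤ 𝟙 (spare? col Γ O a) + 𝟙 (spare? col Γ O′ a)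
    pointwise a with free? col a
    ... | no _  = z≤n
    ... | yes _ = leads-into-exchange Γ O O′ (t a) (h a)

  module Augmentation (col : Colouring) (covered : Covered col) (i : Fin k) where

    Tight : Subset n → Subset n → Set
    Tight Γ O = spare col Γ O ≤ wanted col Γ O

    -- Giving `a` the colour `i` would remove a spare arc here without satisfying a demand, and a
    -- tight set has no spare arc to lose.
    Blocking : Subset n → Fin m → Subset n → Set
    Blocking Γ a O = (t a ∉ O × h a ∈ O ∩ Γ) × ¬ Wants col Γ O i × Tight Γ O

    blocking? : ∀ Γ a → Decidable (Blocking Γ a)
    blocking? Γ a O = leads-into? Γ (t a) (h a) O ×-dec ¬? (wants? col Γ O i) ×-dec (_ ≤? _)

    reached-mono : ∀ {a} → Free col a → ∀ {j x} → Reached col j x → Reached (col [ a ]≔ just i) j x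
    reached-mono     _  (inj₁ eq)            = inj₁ eq
    reached-mono {a} fr (inj₂ (b , cb , eq)) = inj₂ (b , trans (lookup∘update′ b≢a col _) cb , eq)
      where
      b≢a : b ≢ a
      b≢a refl = case trans (sym cb) fr of λ ()

    -- A bi-set that `a` does not enter keeps its spare arcs, and its demand can only fall. One that
    -- `a` enters loses one spare arc: if it wanted `i`, its demand falls by at least one as well;
    -- if not, it was not tight, since nothing blocks `a`.
    covered-update : ∀ {Γ a} → IsAtom U Γ → Free col a → h a ∈ Γ →
                     ¬ ∃ (Blocking Γ a) → Covered (col [ a ]≔ just i)
    covered-update {Γ} {a} at fr ha∈Γ unblocked Γ′ at′ O ne with leads-into? Γ′ (t a) (h a) O
    ... | no ¬leads = ≤-trans wanted≤ (≤-trans (covered Γ′ at′ O ne) (∑-mono spare≤))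
      where
      col′ = col [ a ]≔ just i
      wanted≤ : wanted col′ Γ′ O ≤ wanted col Γ′ O
      wanted≤ = ∑-mono λ j → 𝟙-mono (wants? col′ Γ′ O j) (wants? col Γ′ O j) λ w x x∈O →
        (λ x∈Γ → proj₁ (proj₁ (w x x∈O) x∈Γ) , proj₂ (proj₁ (w x x∈O) x∈Γ) ∘ reached-mono fr {j}) ,
        proj₂ (w x x∈O)
      spare≤ : ∀ b → 𝟙 (spare? col Γ′ O b) ≤ 𝟙 (spare? col′ Γ′ O b)
      spare≤ b = 𝟙-mono (spare? col Γ′ O b) (spare? col′ Γ′ O b) λ { (fb , leads) →
        trans (lookup∘update′ (λ { refl → ¬leads leads }) col _) fb , leads }
    ... | yes (ta∉O , ha∈) with atom-unique at′ at (∈∩ʳ ha∈) ha∈Γ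
    ...   | refl = ≤-pred (≤-trans wanted< spare≤)
      where
      col′ = col [ a ]≔ just i
      spare≤ : spare col Γ O ≤ suc (spare col′ Γ O)
      spare≤ = ∑-mono-except a
        (≤-trans (𝟙-mono (spare? col Γ O a) (yes ha∈) (λ _ → ha∈)) (s≤s z≤n))
        λ b b≢a → 𝟙-mono (spare? col Γ O b) (spare? col′ Γ O b) λ { (fb , leads) →
          trans (lookup∘update′ b≢a col _) fb , leads }
      weaken : ∀ j → Wants col′ Γ O j → Wants col Γ O j
      weaken j w x x∈O =
        (λ x∈Γ → proj₁ (proj₁ (w x x∈O) x∈Γ) , proj₂ (proj₁ (w x x∈O) x∈Γ) ∘ reached-mono fr {j}) ,
        proj₂ (w x x∈O)
      pointwise : ∀ j → 𝟙 (wants? col′ Γ O j) ≤ 𝟙 (wants? col Γ O j)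
      pointwise j = 𝟙-mono (wants? col′ Γ O j) (wants? col Γ O j) (weaken j)
      ¬wants′ : ¬ Wants col′ Γ O i
      ¬wants′ w = proj₂ (proj₁ (w (h a) (∈∩ˡ ha∈)) (∈∩ʳ ha∈)) (inj₂ (a , lookup∘update a col _ , refl))
      wanted< : wanted col′ Γ O < spare col Γ O
      wanted< with wants? col Γ O i
      ... | yes w = <-≤-trans (∑-mono-< pointwise i
              (subst₂ _<_ (sym (𝟙-no (wants? col′ Γ O i) ¬wants′)) (sym (𝟙-yes (wants? col Γ O i) w)) ≤-refl))
              (covered Γ at O ne)
      ... | no ¬w = ≤-<-trans (∑-mono pointwise) (≰⇒> λ tight → unblocked (O , (ta∉O , ha∈) , ¬w , tight))

    record Usable (Γ : Subset n) : Set where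
      field
        link      : Fin m
        free      : Free col link
        head∈Γ    : h link ∈ Γ
        unreached : ¬ Reached col i (h link)
        tail      : (t link ∈ Γ × Reached col i (t link)) ⊎ (t link ∉ Γ × t link ∈ U i)
        unblocked : ¬ ∃ (Blocking Γ link)

    -- Deleting from a tight set O what colour i can start from makes i wanted,
    -- so some arc enters the rest but not O.  If O′ blocks that arc, then O ∩ O′
    -- is tight too, and smaller because the tail lies in O ─ O′.
    usable : ∀ {Γ w} → IsAtom U Γ → ¬ Reached col i w → w ∈ U i → ∀ O → Acc _<_ ∣ O ∣ → w ∈ O ∩ Γ →
             ¬ Wants col Γ O i → Tight Γ O → Usable Γ
    usable {Γ} {w} at ¬rw w∈U O (acc smaller) w∈ ¬wants tight =
      case anySubset? (blocking? Γ a) of λ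
        { (no ¬blocked) → record
            { link = a ; free = a-free ; head∈Γ = ∈∩ʳ ha∈ ; unreached = ¬rh ; tail = tail
            ; unblocked = ¬blocked }
        ; (yes (O′ , (ta∉O′ , ha∈O′) , ¬wants′ , tight′)) →
            let O∩O′ = O ∩ O′
                x∈   = ∈∩⁺ (∈∩⁺ (∈∩ˡ ha∈O) (∈∩ˡ ha∈O′)) (∈∩ʳ ha∈)
                h∪   = covered Γ at (O ∪ O′) (h a , ∈∩⁺ (∈∪ˡ (∈∩ˡ ha∈O)) (∈∩ʳ ha∈))
                h∩   = covered Γ at O∩O′ (h a , x∈)
            in usable at ¬rh (atom-∼ at (∈∩ʳ w∈) (∈∩ʳ ha∈) i w∈U) O∩O′
                 (smaller (p⊂q⇒∣p∣<∣q∣ (∈∩ˡ , t a , ta∈O , ta∉O′ ∘ ∈∩ʳ))) x∈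
                 (λ w∩ → <⇒≱ (strict O′ ¬wants′ w∩)
                     (≤-trans (+-mono-≤ h∩ h∪)
                       (≤-trans (spare-submodular col Γ O O′) (+-mono-≤ tight tight′))))
                 (+-cancelʳ-≤ (spare col Γ (O ∪ O′)) _ _
                   (≤-trans (spare-submodular col Γ O O′)
                     (≤-trans (+-mono-≤ tight tight′)
                       (≤-trans (wanted-supermodular col Γ O O′)
                         (+-monoʳ-≤ (wanted col Γ O∩O′) h∪)))))
        }
      where
      Kept : Fin n → Set
      Kept x = x ∈ O × (x ∈ Γ → ¬ Reached col i x) × (x ∈ U i → x ∈ Γ)
      kept? : Decidable Kept
      kept? x = (x ∈? O) ×-dec ((x ∈? Γ) →-dec ¬? (reached? col i x)) ×-dec ((x ∈? U i) →-dec (x ∈? Γ))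
      O* : Subset n
      O* = ⟪ kept? ⟫
      O*⊆O : O* ⊆ O
      O*⊆O = proj₁ ∘ ∈⟪⟫⁻ kept?
      wants* : Wants col Γ O* i
      wants* x x∈ = let _ , ¬rx , U→Γ = ∈⟪⟫⁻ kept? x∈ in
        (λ x∈Γ → atom-∼ at (∈∩ʳ w∈) x∈Γ i w∈U , ¬rx x∈Γ) , U→Γ
      wanted<* : wanted col Γ O < wanted col Γ O*
      wanted<* = ∑-mono-<
        (λ j → 𝟙-mono (wants? col Γ O j) (wants? col Γ O* j) (wants-antitone col {i = j} O*⊆O)) i
        (subst₂ _<_ (sym (𝟙-no (wants? col Γ O i) ¬wants)) (sym (𝟙-yes (wants? col Γ O* i) wants*)) ≤-refl)
      w∈O* : w ∈ O* ∩ Γ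
      w∈O* = ∈∩⁺ (∈⟪⟫⁺ kept? (∈∩ˡ w∈ , (λ _ → ¬rw) , λ _ → ∈∩ʳ w∈)) (∈∩ʳ w∈)
      witness : ∃ λ a → 𝟙 (spare? col Γ O a) < 𝟙 (spare? col Γ O* a)
      witness = ∑-<-witness (≤-<-trans tight (<-≤-trans wanted<* (covered Γ at O* (w , w∈O*))))
      a = proj₁ witness
      ¬spare×spare* = 𝟙-< (spare? col Γ O a) (spare? col Γ O* a) (proj₂ witness)
      a-free = proj₁ (proj₂ ¬spare×spare*)
      ta∉O* = proj₁ (proj₂ (proj₂ ¬spare×spare*))
      ha∈ = proj₂ (proj₂ (proj₂ ¬spare×spare*))
      ha∈O : h a ∈ O ∩ Γ
      ha∈O = ∈∩⁺ (O*⊆O (∈∩ˡ ha∈)) (∈∩ʳ ha∈)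
      ¬rh : ¬ Reached col i (h a)
      ¬rh = proj₁ (proj₂ (∈⟪⟫⁻ kept? (∈∩ˡ ha∈))) (∈∩ʳ ha∈)
      ta∈O : t a ∈ O
      ta∈O = decidable-stable (t a ∈? O) λ ta∉O → proj₁ ¬spare×spare* (a-free , ta∉O , ha∈O)
      -- The tail lies in `O` but was deleted from it: inside `Γ` only reached vertices are deleted,
      -- outside `Γ` only vertices of `U i`.
      tail : (t a ∈ Γ × Reached col i (t a)) ⊎ (t a ∉ Γ × t a ∈ U i)
      tail with t a ∈? Γ
      ... | yes ta∈Γ = inj₁ (ta∈Γ , decidable-stable (reached? col i (t a)) λ ¬rt →
                         ta∉O* (∈⟪⟫⁺ kept? (ta∈O , (λ _ → ¬rt) , λ _ → ta∈Γ)))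
      ... | no ta∉Γ = inj₂ (ta∉Γ , decidable-stable (t a ∈? U i) λ ta∉U →
                         ta∉O* (∈⟪⟫⁺ kept? (ta∈O , (λ ta∈Γ → ⊥-elim (ta∉Γ ta∈Γ)) , ⊥-elim ∘ ta∉U)))
      -- Colour `i` alone makes supermodularity strict: it is wanted at neither set but at their
      -- intersection. Two tight sets cannot afford this, so `O ∩ O′` does not want `i` either and
      -- the search can continue from it.
      strict : ∀ O′ → ¬ Wants col Γ O′ i → Wants col Γ (O ∩ O′) i →
               wanted col Γ O + wanted col Γ O′ < wanted col Γ (O ∩ O′) + wanted col Γ (O ∪ O′)
      strict O′ ¬wants′ w∩ = subst₂ _<_ (∑-+ (𝟙 ∘ wants? col Γ O) (𝟙 ∘ wants? col Γ O′))
        (∑-+ (𝟙 ∘ wants? col Γ (O ∩ O′)) (𝟙 ∘ wants? col Γ (O ∪ O′)))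
        (∑-mono-< (wants-exchange col Γ O O′) i
          (subst₂ _<_ (sym (cong₂ _+_ (𝟙-no (wants? col Γ O i) ¬wants) (𝟙-no (wants? col Γ O′ i) ¬wants′)))
                      (sym (cong (_+ 𝟙 (wants? col Γ (O ∪ O′) i)) (𝟙-yes (wants? col Γ (O ∩ O′) i) w∩))) (s≤s z≤n)))

    record Augmenting : Set where
      field
        link      : Fin m
        free      : Free col link
        tail      : Reached col i (t link)
        unreached : ¬ Reached col i (h link)
        preserved : Covered (col [ link ]≔ just i)

    rank : Fin n → ℕ
    rank v = ∑ (λ j → 𝟙 (v ∈? U j))

    -- A usable arc whose tail lies outside the atom may have an unreached tail;
    -- then restart from the tail, which belongs to fewer of the sets U j.
    augmenting : ∀ v → Acc _<_ (rank v) → v ∈ U i → ¬ Reached col i v → Augmenting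
    augmenting v (acc lower) v∈U ¬rv = case reached? col i (t link) of λ
      { (yes rt) → record
          { link = link ; free = free ; tail = rt ; unreached = unreached
          ; preserved = covered-update at free head∈Γ unblocked }
      ; (no ¬rt) → case tail of λ
          { (inj₁ (_ , rt))     → ⊥-elim (¬rt rt)
          ; (inj₂ (t∉Γ , t∈U)) → augmenting (t link) (lower (rank< t∉Γ)) t∈U ¬rt } }
      where
      Γ = atom v
      at = atom-isAtom v
      v∈Γ = ∈atom v
      -- The search starts from all vertices. No arc enters `⊤`, so it is tight; and `r i` prevents
      -- `⊤` from wanting `i`, either as a reached vertex of the atom or as a vertex of `U i`
      -- outside it.
      ¬wants⊤ : ¬ Wants col Γ ⊤ i
      ¬wants⊤ w = let wr = w (r i) ∈⊤ in proj₂ (proj₁ wr (proj₂ wr (r∈U i))) (inj₁ refl)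
      tight⊤ : Tight Γ ⊤
      tight⊤ = ≤-trans (≤-reflexive (trans (∑-cong λ a → 𝟙-no (spare? col Γ ⊤ a) λ { (_ , t∉⊤ , _) → t∉⊤ ∈⊤ })
                                           (∑-zero {m}))) z≤n
      open Usable (usable at ¬rv v∈U ⊤ (<-wellFounded _) (∈∩⁺ ∈⊤ v∈Γ) ¬wants⊤ tight⊤)
      down : ∀ j → t link ∈ U j → v ∈ U j
      down j = atom-∼ at head∈Γ v∈Γ j ∘ closed link j
      -- No arc leaves a set `U j`, so every `U j` containing the tail contains `v`; were these all
      -- the sets around `v`, the tail would lie in the atom of `v`.
      rank< : t link ∉ Γ → rank (t link) < rank v
      rank< t∉Γ =
        let j , ¬imp = ¬∀⟶∃¬ k _ (λ j → (v ∈? U j) →-dec (t link ∈? U j))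
                         (λ up → t∉Γ (atom-closed at v∈Γ (λ j → mk⇔ (up j) (down j))))
            v∈Uj = decidable-stable (v ∈? U j) (λ v∉ → ¬imp (⊥-elim ∘ v∉))
        in ∑-mono-< (λ j → 𝟙-mono (t link ∈? U j) (v ∈? U j) (down j)) j
             (subst₂ _<_ (sym (𝟙-no (t link ∈? U j) (λ t∈ → ¬imp (λ _ → t∈))))
                         (sym (𝟙-yes (v ∈? U j) v∈Uj)) ≤-refl)

  -- `Reached` looks only at heads of coloured arcs and would accept a coloured cycle away from the
  -- root; a derivation here is a coloured walk from the root.
  data Grown (col : Colouring) (i : Fin k) : Fin n → Set where
    root : Grown col i (r i)
    grow : ∀ a → Coloured col i a → Grown col i (t a) → Grown col i (h a)

  record Forest (col : Colouring) : Set where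
    field
      heads-distinct : ∀ {i a b} → Coloured col i a → Coloured col i b → h a ≡ h b → a ≡ b
      heads-not-root : ∀ {i a} → Coloured col i a → h a ≢ r i
      loopless       : ∀ {i a} → Coloured col i a → t a ≢ h a
      tail-grown     : ∀ {i a} → Coloured col i a → Grown col i (t a)

    grown : ∀ {i x} → Reached col i x → Grown col i x
    grown (inj₁ refl)            = root
    grown (inj₂ (a , ca , refl)) = grow a ca (tail-grown ca)

    grown⊆U : ∀ {i x} → Grown col i x → x ∈ U i
    grown⊆U root         = r∈U _
    grown⊆U (grow a _ g) = closed a _ (grown⊆U g)

  open Augmentation using (Augmenting; augmenting; reached-mono)

  extend : ∀ {col} (cov : Covered col) → Forest col → ∀ {i} (A : Augmenting col cov i) →
           Forest (col [ Augmenting.link A ]≔ just i)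
  extend {col} cov F {i} A = record
    { heads-distinct = distinct ; heads-not-root = not-root ; loopless = no-loop ; tail-grown = tail-grown′ }
    where
    open Augmenting A
    open Forest F
    col′ = col [ link ]≔ just i
    old-or-new : ∀ {j b} → Coloured col′ j b → (b ≡ link × j ≡ i) ⊎ Coloured col j b
    old-or-new {j} {b} cb with b ≟ link
    ... | yes refl = inj₁ (refl , just-injective (trans (sym cb) (lookup∘update link col _)))
    ... | no b≢    = inj₂ (trans (sym (lookup∘update′ b≢ col _)) cb)
    distinct : ∀ {j a b} → Coloured col′ j a → Coloured col′ j b → h a ≡ h b → a ≡ b
    distinct {b = b} ca cb eq with old-or-new ca | old-or-new cb
    ... | inj₁ (refl , _)    | inj₁ (refl , _)    = refl
    ... | inj₁ (refl , refl) | inj₂ cb′           = contradiction (inj₂ (_ , cb′ , sym eq)) unreached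
    ... | inj₂ ca′           | inj₁ (refl , refl) = contradiction (inj₂ (_ , ca′ , eq)) unreached
    ... | inj₂ ca′           | inj₂ cb′           = heads-distinct ca′ cb′ eq
    not-root : ∀ {j a} → Coloured col′ j a → h a ≢ r j
    not-root ca eq with old-or-new ca
    ... | inj₁ (refl , refl) = unreached (inj₁ (sym eq))
    ... | inj₂ ca′           = heads-not-root ca′ eq
    lift : ∀ {j x} → Grown col j x → Grown col′ j x
    lift root = root
    lift (grow b cb g) = grow b (trans (lookup∘update′ (λ { refl → case trans (sym cb) free of λ () }) col _) cb) (lift g)
    no-loop : ∀ {j a} → Coloured col′ j a → t a ≢ h a
    no-loop ca eq with old-or-new ca
    ... | inj₁ (refl , refl) = unreached (subst (Reached col i) eq tail)
    ... | inj₂ ca′           = loopless ca′ eq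
    tail-grown′ : ∀ {j a} → Coloured col′ j a → Grown col′ j (t a)
    tail-grown′ ca with old-or-new ca
    ... | inj₁ (refl , refl) = lift (grown tail)
    ... | inj₂ ca′           = lift (tail-grown ca′)

  frees : Colouring → ℕ
  frees col = ∑ (λ a → 𝟙 (free? col a))

  frees< : ∀ {col a i} → Free col a → frees (col [ a ]≔ just i) < frees col
  frees< {col} {a} {i} fr = ∑-mono-<
    (λ b → 𝟙-mono (free? col′ b) (free? col b) λ fb →
       trans (sym (lookup∘update′ (λ { refl → ¬free′ fb }) col _)) fb)
    a (subst₂ _<_ (sym (𝟙-no (free? col′ a) ¬free′)) (sym (𝟙-yes (free? col a) fr)) ≤-refl)
    where
    col′ = col [ a ]≔ just i
    ¬free′ : ¬ Free col′ a
    ¬free′ fa = case trans (sym (lookup∘update a col _)) fa of λ ()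

  Spanning : Colouring → Set
  Spanning col = ∀ i v → v ∈ U i → Reached col i v

  complete : ∀ col → Acc _<_ (frees col) → Covered col → Forest col →
             ∃ λ col → Forest col × Spanning col
  complete col (acc fewer) cov F
    with any? (λ i → any? λ v → (v ∈? U i) ×-dec ¬? (reached? col i v))
  ... | no ¬missing = col , F , λ i v v∈U → decidable-stable (reached? col i v) λ ¬rv → ¬missing (i , v , v∈U , ¬rv)
  ... | yes (i , v , v∈U , ¬rv) =
    let A = augmenting col cov i v (<-wellFounded _) v∈U ¬rv
        open Augmenting A in
    complete (col [ link ]≔ just i) (fewer (frees< {col} free)) preserved (extend cov F A)

-- Orienting the edges

∈─⇒∉ : ∀ {n x} (p q : Subset n) → x ∈ p ─ q → x ∉ q
∈─⇒∉ (_ ∷ p) (outside ∷ q) (there x∈) (there x∈q) = ∈─⇒∉ p q x∈ x∈q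
∈─⇒∉ (_ ∷ p) (inside ∷ q)  (there x∈) (there x∈q) = ∈─⇒∉ p q x∈ x∈q

-- Φ need not be decidable, hence the double negation.
choose : ∀ m (Φ : Vec (Maybe Bool) m → Set) →
  (∀ σ e → lookup σ e ≡ nothing → Φ σ → ¬ (¬ Φ (σ [ e ]≔ just true) × ¬ Φ (σ [ e ]≔ just false))) →
  Φ (replicate m nothing) → ¬ ¬ ∃ λ (o : Vec Bool m) → Φ (map just o)
choose zero    Φ step φ none = none ([] , φ)
choose (suc m) Φ step φ none = choose m (Φ ∘ (nothing ∷_)) (λ σ e → step (nothing ∷ σ) (suc e)) φ
  λ { (o , φ′) → step (nothing ∷ map just o) zero refl φ′
        ((λ φ₁ → none (true ∷ o , φ₁)) , (λ φ₂ → none (false ∷ o , φ₂))) }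

headOf tailOf : ∀ {a} {A : Set a} → Bool → A × A → A
headOf true  = proj₂
headOf false = proj₁
tailOf true  = proj₁
tailOf false = proj₂

-- An edge that is not yet oriented may still become an arc into either end.
Touches : ∀ {n} → Maybe Bool → Fin n × Fin n → Subset n → Set
Touches nothing  (u , v) Z = u ∈ Z ⊎ v ∈ Z
Touches (just b) ends    Z = headOf b ends ∈ Z

touches? : ∀ {n} d (ends : Fin n × Fin n) → Decidable (Touches d ends)
touches? nothing  (u , v) Z = (u ∈? Z) ⊎-dec (v ∈? Z)
touches? (just b) ends    Z = headOf b ends ∈? Z

-- For fixed `d`, touching means meeting a fixed set: both ends, or the head alone. The indicator of
-- meeting a fixed set is submodular.
touches-exchange : ∀ {n} d (ends : Fin n × Fin n) (Z W : Subset n) →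
  𝟙 (touches? d ends (Z ∪ W)) + 𝟙 (touches? d ends (Z ∩ W))
    ≤ 𝟙 (touches? d ends Z) + 𝟙 (touches? d ends W)
touches-exchange d ends Z W =
  𝟙-exchange (touches? d ends (Z ∪ W)) (touches? d ends (Z ∩ W)) (touches? d ends Z) (touches? d ends W)
    (∪⁻ d) (λ x → inj₁ (proj₁ (∩⁻ d x))) (λ _ → ∩⁻ d)
  where
  ∪⁻ : ∀ d → Touches d ends (Z ∪ W) → Touches d ends Z ⊎ Touches d ends W
  ∪⁻ nothing  (inj₁ u∈) = ⊎-map inj₁ inj₁ (∈∪⁻ u∈)
  ∪⁻ nothing  (inj₂ v∈) = ⊎-map inj₂ inj₂ (∈∪⁻ v∈)
  ∪⁻ (just b) h∈        = ∈∪⁻ h∈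
  ∩⁻ : ∀ d → Touches d ends (Z ∩ W) → Touches d ends Z × Touches d ends W
  ∩⁻ nothing  (inj₁ u∈) = inj₁ (∈∩ˡ u∈) , inj₁ (∈∩ʳ u∈)
  ∩⁻ nothing  (inj₂ v∈) = inj₂ (∈∩ˡ v∈) , inj₂ (∈∩ʳ v∈)
  ∩⁻ (just b) h∈        = ∈∩ˡ h∈ , ∈∩ʳ h∈

module Orienting (F : MixedGraph) {k : ℕ}
  (r : Fin k → MixedGraph.Vertex F) (U : Fin k → Subset (MixedGraph.#V F))
  (edge-closed : ∀ e i → proj₁ (MixedGraph.ends F e) ∈ U i ⇔ proj₂ (MixedGraph.ends F e) ∈ U i) where

  open MixedGraph F
  open Atoms U
  open Wanting U (λ i x → r i ≡ x) (λ i x → r i ≟ x)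

  inside? : ∀ Γ O → Decidable (λ e → proj₁ (ends e) ∈ O ∩ Γ × proj₂ (ends e) ∈ O ∩ Γ)
  inside? Γ O e = (_ ∈? _) ×-dec (_ ∈? _)

  insides : Subset #V → Subset #V → ℕ
  insides Γ O = ∑ (λ e → 𝟙 (inside? Γ O e))

  insides-supermodular : ∀ Γ O O′ → insides Γ O + insides Γ O′ ≤ insides Γ (O ∩ O′) + insides Γ (O ∪ O′)
  insides-supermodular Γ O O′ =
    ∑-exchange _ _ (𝟙 ∘ inside? Γ (O ∩ O′)) (𝟙 ∘ inside? Γ (O ∪ O′)) λ e →
      𝟙-exchange (inside? Γ O e) (inside? Γ O′ e) (inside? Γ (O ∩ O′) e) (inside? Γ (O ∪ O′) e)
        (λ { (u , v) → inj₂ (∈∩⁺ (∈∪ˡ (∈∩ˡ u)) (∈∩ʳ u) , ∈∩⁺ (∈∪ˡ (∈∩ˡ v)) (∈∩ʳ v)) })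
        (λ { (u , v) → inj₂ (∈∩⁺ (∈∪ʳ (∈∩ˡ u)) (∈∩ʳ u) , ∈∩⁺ (∈∪ʳ (∈∩ˡ v)) (∈∩ʳ v)) })
        (λ { (u , v) (u′ , v′) →
             (∈∩⁺ (∈∩⁺ (∈∩ˡ u) (∈∩ˡ u′)) (∈∩ʳ u) , ∈∩⁺ (∈∩⁺ (∈∩ˡ v) (∈∩ˡ v′)) (∈∩ʳ v)) ,
             (∈∩⁺ (∈∪ˡ (∈∩ˡ u)) (∈∩ʳ u) , ∈∩⁺ (∈∪ˡ (∈∩ˡ v)) (∈∩ʳ v)) })

  -- The edges that cross a family P and those inside its members together are
  -- the edges that touch the union of P.  Counting inside edges as gain turns the
  -- subpartition condition into gain ≤ touching + cost, where only touching
  -- depends on the orientation and only on the union of the family.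
  gain cost : Subset #V → Subset #V → ℕ
  gain Γ O = wanted Γ O + insides Γ O
  cost Γ O = ∑ (λ a → 𝟙 (leads-into? Γ (tail a) (head a) O))

  gain-supermodular : ∀ Γ O O′ → gain Γ O + gain Γ O′ ≤ gain Γ (O ∩ O′) + gain Γ (O ∪ O′)
  gain-supermodular Γ O O′ = begin
    gain Γ O + gain Γ O′ ≡⟨ +-interchange (wanted Γ O) _ _ _ ⟩
    (wanted Γ O + wanted Γ O′) + (insides Γ O + insides Γ O′)
      ≤⟨ +-mono-≤ (wanted-supermodular Γ O O′) (insides-supermodular Γ O O′) ⟩
    (wanted Γ (O ∩ O′) + wanted Γ (O ∪ O′)) + (insides Γ (O ∩ O′) + insides Γ (O ∪ O′))
      ≡⟨ +-interchange (wanted Γ (O ∩ O′)) _ _ _ ⟩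
    gain Γ (O ∩ O′) + gain Γ (O ∪ O′) ∎
    where open ≤-Reasoning

  cost-submodular : ∀ Γ O O′ → cost Γ (O ∩ O′) + cost Γ (O ∪ O′) ≤ cost Γ O + cost Γ O′
  cost-submodular Γ O O′ = ∑-exchange _ _
    (λ a → 𝟙 (leads-into? Γ (tail a) (head a) O)) (λ a → 𝟙 (leads-into? Γ (tail a) (head a) O′))
    (λ a → leads-into-exchange Γ O O′ (tail a) (head a))

  module Fam Γ = Families Γ (gain Γ) (cost Γ) (gain-supermodular Γ) (cost-submodular Γ)
  open Fam using (Family; []; add; uncross; indexed; Indexed)

  family-⊆ : ∀ Γ {Z a c} → Family Γ Z a c → Z ⊆ Γ
  family-⊆ Γ []               = ⊥-elim ∘ ∉⊥
  family-⊆ Γ (add O ne disj F) = [ ∈∩ʳ , family-⊆ Γ F ]′ ∘ ∈∪⁻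

  Orientation : Set
  Orientation = Vec (Maybe Bool) #E

  touch : Orientation → Edge → Subset #V → ℕ
  touch σ e Z = 𝟙 (touches? (lookup σ e) (ends e) Z)

  touch-cong : ∀ {σ e d} Z → lookup σ e ≡ d → touch σ e Z ≡ 𝟙 (touches? d (ends e) Z)
  touch-cong {e = e} Z eq = cong (λ d → 𝟙 (touches? d (ends e) Z)) eq

  touching : Orientation → Subset #V → ℕ
  touching σ Z = ∑ (λ e → touch σ e Z)

  Feasible : Orientation → Set
  Feasible σ = ∀ Γ → IsAtom U Γ → ∀ {Z a c} → Family Γ Z a c → a ≤ touching σ Z + c

  -- Orienting `e` can cost `Z` something only if the tail lies in `Z` and the head does not. Read
  -- backwards, a violation created by the orientation locates both ends of `e`.
  touching-update : ∀ σ e b Z → lookup σ e ≡ nothing →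
    (tailOf b (ends e) ∈ Z → headOf b (ends e) ∈ Z) →
    touching σ Z ≤ touching (σ [ e ]≔ just b) Z
  touching-update σ e b Z free t⇒h = ∑-mono pointwise
    where
    open ≤-Reasoning
    toHead : ∀ b → (tailOf b (ends e) ∈ Z → headOf b (ends e) ∈ Z) →
             Touches nothing (ends e) Z → headOf b (ends e) ∈ Z
    toHead true  f = [ f , id ]′
    toHead false f = [ id , f ]′
    pointwise : ∀ e′ → touch σ e′ Z ≤ touch (σ [ e ]≔ just b) e′ Z
    pointwise e′ with e′ ≟ e
    ... | yes refl = begin
      touch σ e Z                           ≡⟨ touch-cong {σ} Z free ⟩
      𝟙 (touches? nothing (ends e) Z)       ≤⟨ 𝟙-mono (touches? nothing (ends e) Z) (headOf b (ends e) ∈? Z) (toHead b t⇒h) ⟩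
      𝟙 (headOf b (ends e) ∈? Z)            ≡⟨ touch-cong {σ [ e ]≔ just b} Z (lookup∘update e σ (just b)) ⟨
      touch (σ [ e ]≔ just b) e Z           ∎
    ... | no e′≢e = ≤-reflexive (sym (touch-cong {σ [ e ]≔ just b} Z (lookup∘update′ e′≢e σ (just b))))

  -- Away from `e` this is submodularity. At `e` the left side is exactly one, as the undecided edge
  -- touches the union at its first end and misses the intersection; the extra one on the right
  -- covers it.
  touching-exchange : ∀ σ e {Z W} → lookup σ e ≡ nothing →
    proj₁ (ends e) ∈ Z → proj₂ (ends e) ∉ Z → proj₁ (ends e) ∉ W →
    touching σ (Z ∪ W) + touching σ (Z ∩ W)
      ≤ suc (touching (σ [ e ]≔ just true) Z + touching (σ [ e ]≔ just false) W)
  touching-exchange σ e {Z} {W} free u∈Z v∉Z u∉W = begin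
    touching σ (Z ∪ W) + touching σ (Z ∩ W)
      ≡⟨ ∑-+ (λ e′ → touch σ e′ (Z ∪ W)) (λ e′ → touch σ e′ (Z ∩ W)) ⟨
    ∑ (λ e′ → touch σ e′ (Z ∪ W) + touch σ e′ (Z ∩ W))
      ≤⟨ ∑-mono-except e at-e elsewhere ⟩
    suc (∑ (λ e′ → touch σ₁ e′ Z + touch σ₂ e′ W))
      ≡⟨ cong suc (∑-+ (λ e′ → touch σ₁ e′ Z) (λ e′ → touch σ₂ e′ W)) ⟩
    suc (touching σ₁ Z + touching σ₂ W) ∎
    where
    open ≤-Reasoning
    σ₁ = σ [ e ]≔ just true
    σ₂ = σ [ e ]≔ just false
    at-e : touch σ e (Z ∪ W) + touch σ e (Z ∩ W) ≤ suc (touch σ₁ e Z + touch σ₂ e W)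
    at-e = begin
      touch σ e (Z ∪ W) + touch σ e (Z ∩ W)
        ≡⟨ cong₂ _+_ (touch-cong {σ} (Z ∪ W) free) (touch-cong {σ} (Z ∩ W) free) ⟩
      𝟙 (touches? nothing (ends e) (Z ∪ W)) + 𝟙 (touches? nothing (ends e) (Z ∩ W))
        ≡⟨ cong₂ _+_ (𝟙-yes (touches? nothing (ends e) (Z ∪ W)) (inj₁ (∈∪ˡ u∈Z)))
                     (𝟙-no (touches? nothing (ends e) (Z ∩ W)) [ u∉W ∘ ∈∩ʳ , v∉Z ∘ ∈∩ˡ ]′) ⟩
      1 ≤⟨ s≤s z≤n ⟩
      suc (touch σ₁ e Z + touch σ₂ e W) ∎
    elsewhere : ∀ e′ → e′ ≢ e → touch σ e′ (Z ∪ W) + touch σ e′ (Z ∩ W) ≤ touch σ₁ e′ Z + touch σ₂ e′ W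
    elsewhere e′ e′≢e = begin
      touch σ e′ (Z ∪ W) + touch σ e′ (Z ∩ W) ≤⟨ touches-exchange (lookup σ e′) (ends e′) Z W ⟩
      touch σ e′ Z + touch σ e′ W
        ≡⟨ cong₂ _+_ (touch-cong {σ₁} Z (lookup∘update′ e′≢e σ (just true)))
                     (touch-cong {σ₂} W (lookup∘update′ e′≢e σ (just false))) ⟨
      touch σ₁ e′ Z + touch σ₂ e′ W ∎

  -- A tight family that loses e when e points out of its union and one that
  -- loses e when e points back cannot coexist: uncrossing them, e touches
  -- both unions, but it touches the union of the two and not their intersection.
  orient-edge : ∀ σ e → lookup σ e ≡ nothing → Feasible σ →
                ¬ (¬ Feasible (σ [ e ]≔ just true) × ¬ Feasible (σ [ e ]≔ just false))
  orient-edge σ e free feasible (no₁ , no₂) =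
    no₁ λ Γ at {Z} {a} {c} F → ≮⇒≥ λ viol₁ →
    no₂ λ Γ′ at′ {W} {b} {d} G → ≮⇒≥ λ viol₂ →
    conflict at at′ F G viol₁ viol₂
    where
    σ₁ = σ [ e ]≔ just true
    σ₂ = σ [ e ]≔ just false
    u = proj₁ (ends e)
    v = proj₂ (ends e)
    same-atom : ∀ {Γ Z W a b c d} → IsAtom U Γ → Family Γ Z a c → Family Γ W b d →
                touching σ₁ Z + c < a → touching σ₂ W + d < b → u ∈ Z → v ∉ Z → ¬ u ∉ W
    same-atom {Γ} {Z} {W} {a} {b} {c} {d} at F G viol₁ viol₂ u∈Z v∉Z u∉W = <⇒≱ step₁ step₂
      where
      open ≤-Reasoning
      open Fam.Uncrossed Γ (uncross Γ F G) renaming (first to F₁; second to F₂)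
      -- Two violations give an excess of two, while exchanging at `e` costs only one.
      step₁ : suc (touching σ₁ Z + touching σ₂ W) + (c + d) < a + b
      step₁ = begin-strict
        suc (touching σ₁ Z + touching σ₂ W) + (c + d)
          ≡⟨ cong suc (+-interchange (touching σ₁ Z) (touching σ₂ W) c d) ⟩
        suc (touching σ₁ Z + c) + (touching σ₂ W + d) <⟨ +-mono-≤-< viol₁ viol₂ ⟩
        a + b ∎
      step₂ : a + b ≤ suc (touching σ₁ Z + touching σ₂ W) + (c + d)
      step₂ = begin
        a + b     ≤⟨ gain≤ ⟩
        a₁ + a₂   ≤⟨ +-mono-≤ (feasible Γ at F₁) (feasible Γ at F₂) ⟩
        (touching σ (Z ∪ W) + c₁) + (touching σ (Z ∩ W) + c₂)
          ≡⟨ +-interchange (touching σ (Z ∪ W)) c₁ (touching σ (Z ∩ W)) c₂ ⟩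
        (touching σ (Z ∪ W) + touching σ (Z ∩ W)) + (c₁ + c₂)
          ≤⟨ +-mono-≤ (touching-exchange σ e free u∈Z v∉Z u∉W) cost≥ ⟩
        suc (touching σ₁ Z + touching σ₂ W) + (c + d) ∎
    conflict : ∀ {Γ Γ′ Z W a b c d} → IsAtom U Γ → IsAtom U Γ′ → Family Γ Z a c → Family Γ′ W b d →
               touching σ₁ Z + c < a → ¬ touching σ₂ W + d < b
    conflict {Γ} {Γ′} {Z} {W} {c = c} {d} at at′ F G viol₁ viol₂ =
      -- Each violation puts the tail of its orientation inside the union and the head outside. The
      -- ends of `e` share an atom, so both families live in the same atom and can be uncrossed.
      same₁ λ u∈Z → decidable-stable (v ∈? Z) λ v∉Z →
      same₂ λ v∈W → decidable-stable (u ∈? W) λ u∉W →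
      same-atom at F
        (subst (λ Γ → Family Γ _ _ _)
          (atom-unique at′ at (family-⊆ Γ′ G v∈W) (atom-closed at (family-⊆ Γ F u∈Z) (edge-closed e))) G)
        viol₁ viol₂ u∈Z v∉Z u∉W
      where
      same₁ : ¬ (u ∈ Z → v ∈ Z)
      same₁ u⇒v = <⇒≱ viol₁ (≤-trans (feasible Γ at F) (+-monoˡ-≤ c (touching-update σ e true Z free u⇒v)))
      same₂ : ¬ (v ∈ W → u ∈ W)
      same₂ v⇒u = <⇒≱ viol₂ (≤-trans (feasible Γ′ at′ G) (+-monoˡ-≤ d (touching-update σ e false W free v⇒u)))

  Condition : Set
  Condition = (t : ℕ) (X : Fin t → BiSet #V) (Γ : Subset #V) →
       IsAtom U Γ →
       IsSubpartition Γ (inner ∘ X) →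
       (∀ s → Empty (wall (X s) ∩ Γ)) →
       eE F (inner ∘ X) + ∑ (λ s → ρ F (X s)) ≥ ∑ (λ s → demand r U (X s))

  wanted≤demand : ∀ Γ O → wanted Γ O ≤ demand r U (trace Γ O)
  wanted≤demand Γ O = ≤-trans
    (∑-mono λ i → 𝟙-mono (wants? Γ O i) (demands? r U (trace Γ O) i) λ w →
      (λ x∈ → proj₁ (proj₁ (w _ (∈∩ˡ x∈)) (∈∩ʳ x∈))) ,
      (λ r∈ → proj₂ (proj₁ (w _ (∈∩ˡ r∈)) (∈∩ʳ r∈)) refl) ,
      λ { (x , x∈) → let x∈O = p─q⊆p O _ (∈∩ˡ x∈) in
          ∈─⇒∉ O _ (∈∩ˡ x∈) (∈∩⁺ x∈O (proj₂ (w x x∈O) (∈∩ʳ x∈))) })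
    (≤-reflexive (sym (#≡∑ (demands? r U (trace Γ O)))))

  feasible-initially : Condition → Feasible (replicate #E nothing)
  feasible-initially condition Γ at {Z} {a} {c} G = begin
    a ≡⟨ gain-sum ⟩
    ∑ (λ s → wanted Γ (part s) + insides Γ (part s))
      ≡⟨ ∑-+ (λ s → wanted Γ (part s)) _ ⟩
    ∑ (λ s → wanted Γ (part s)) + ∑ (λ s → insides Γ (part s))
      ≤⟨ +-monoˡ-≤ _ (≤-trans (∑-mono λ s → wanted≤demand Γ (part s)) (condition size X Γ at subpartition walls)) ⟩
    eE F P + ∑ (λ s → ρ F (X s)) + ∑ (λ s → insides Γ (part s))
      ≡⟨ rearrange (eE F P) _ _ ⟩
    ∑ (λ s → insides Γ (part s)) + eE F P + ∑ (λ s → ρ F (X s))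
      ≤⟨ +-mono-≤ touch≤ (≤-reflexive (trans (∑-cong λ s → #≡∑ (enters? F (X s))) (sym cost-sum))) ⟩
    touching σ Z + c ∎
    where
    open ≤-Reasoning
    open Indexed Γ (indexed Γ G)
    σ = replicate #E nothing
    X : Fin size → BiSet #V
    X s = trace Γ (part s)
    P : Fin size → Subset #V
    P = inner ∘ X
    rearrange : ∀ x y z → x + y + z ≡ z + x + y
    rearrange = solve-∀
    subpartition : IsSubpartition Γ P
    subpartition = record { nonempty = nonempty ; within = λ s → ∈∩ʳ ; disjoint = disjoint }
    walls : ∀ s → Empty (wall (X s) ∩ Γ)
    walls s (x , x∈) = ∈─⇒∉ (part s) _ (∈∩ˡ x∈) (∈∩⁺ (p─q⊆p (part s) _ (∈∩ˡ x∈)) (∈∩ʳ x∈))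
    Touched? : Decidable (λ e → Touches nothing (ends e) Z)
    Touched? e = touches? nothing (ends e) Z
    uncrossed? : Decidable (λ e → Touches nothing (ends e) Z × ¬ Crosses F P e)
    uncrossed? e = Touched? e ×-dec ¬? (crosses? F P e)
    crosses⇒touches : ∀ e → Crosses F P e → Touches nothing (ends e) Z
    crosses⇒touches e (s , inj₁ (u∈ , _)) = inj₁ (within s u∈)
    crosses⇒touches e (s , inj₂ (_ , v∈)) = inj₂ (within s v∈)
    same-part : ∀ {x} s s′ → x ∈ P s → x ∈ P s′ → s ≡ s′
    same-part s s′ x∈ x∈′ = decidable-stable (s ≟ s′) λ s≢s′ → disjoint s s′ s≢s′ (_ , ∈∩⁺ x∈ x∈′)
    inside⇒uncrossed : ∀ e s → proj₁ (ends e) ∈ P s × proj₂ (ends e) ∈ P s →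
                       Touches nothing (ends e) Z × ¬ Crosses F P e
    inside⇒uncrossed e s (u∈ , v∈) = inj₁ (within s u∈) , λ
      { (s′ , inj₁ (u∈′ , v∉)) → v∉ (subst (λ s → _ ∈ P s) (same-part s s′ u∈ u∈′) v∈)
      ; (s′ , inj₂ (u∉ , v∈′)) → u∉ (subst (λ s → _ ∈ P s) (same-part s s′ v∈ v∈′) u∈) }
    touch≤ : ∑ (λ s → insides Γ (part s)) + eE F P ≤ touching σ Z
    touch≤ = begin
      ∑ (λ s → insides Γ (part s)) + eE F P
        ≡⟨ cong₂ _+_ (∑-swap (λ s e → 𝟙 (inside? Γ (part s) e))) (#≡∑ (crosses? F P)) ⟩
      ∑ (λ e → ∑ (λ s → 𝟙 (inside? Γ (part s) e))) + ∑ (λ e → 𝟙 (crosses? F P e))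
        ≡⟨ ∑-+ (λ e → ∑ (λ s → 𝟙 (inside? Γ (part s) e))) (λ e → 𝟙 (crosses? F P e)) ⟨
      ∑ (λ e → ∑ (λ s → 𝟙 (inside? Γ (part s) e)) + 𝟙 (crosses? F P e))
        ≤⟨ ∑-mono pointwise ⟩
      touching σ Z ∎
      where
      pointwise : ∀ e → ∑ (λ s → 𝟙 (inside? Γ (part s) e)) + 𝟙 (crosses? F P e)
                        ≤ touch σ e Z
      pointwise e = begin
        ∑ (λ s → 𝟙 (inside? Γ (part s) e)) + 𝟙 (crosses? F P e)
          ≤⟨ +-monoˡ-≤ _ (∑-at-most-one (λ s → inside? Γ (part s) e) (uncrossed? e) (inside⇒uncrossed e)
               λ s s′ p q → same-part s s′ (proj₁ p) (proj₁ q)) ⟩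
        𝟙 (uncrossed? e) + 𝟙 (crosses? F P e)
          -- The impossible fourth event expresses that the first two exclude each other, so that
          -- together they count as one touching edge.
          ≤⟨ 𝟙-exchange (uncrossed? e) (crosses? F P e) (Touched? e) (⊥-dec {0ℓ})
               (inj₁ ∘ proj₁) (inj₁ ∘ crosses⇒touches e) (λ { (_ , ¬c) c → ⊥-elim (¬c c) }) ⟩
        𝟙 (Touched? e) + 0
          ≡⟨ +-identityʳ _ ⟩
        𝟙 (Touched? e)
          ≡⟨ touch-cong {σ} {e} Z (lookup-replicate e nothing) ⟨
        touch σ e Z ∎

  Violated : Vec Bool #E → Vertex → Subset #V → Set
  Violated o x O = Nonempty (O ∩ atom x) ×
    ¬ (gain (atom x) O ≤ touching (map just o) (O ∩ atom x) + cost (atom x) O)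

  violated? : ∀ o x → Decidable (Violated o x)
  violated? o x O = nonempty? _ ×-dec ¬? (_ ≤? _)

  orientation : Condition → ∃ λ o → ∀ x → ¬ ∃ (Violated o x)
  orientation condition = decidable-stable
    -- A vector of Booleans is a subset of the edges, so all orientations can be searched.
    -- `Violated` is decidable, unlike `Feasible` as stated, and this removes the double negation
    -- left by `choose`.
    (anySubset? λ o → all? λ x → ¬? (anySubset? (violated? o x)))
    λ none → choose #E Feasible orient-edge (feasible-initially condition)
      λ { (o , feasible) → none (o , λ { x (O , ne , violated) → violated (single o feasible x O ne) }) }
    where
    single : ∀ o → Feasible (map just o) → ∀ x O → Nonempty (O ∩ atom x) →
             gain (atom x) O ≤ touching (map just o) (O ∩ atom x) + cost (atom x) O
    single o feasible x O ne = subst₂ _≤_ (+-identityʳ _) (cong (touching (map just o) (O ∩ atom x) +_) (+-identityʳ _))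
      (feasible (atom x) (atom-isAtom x)
        (Fam.transport (atom x) ([ id , ⊥-elim ∘ ∉⊥ ]′ ∘ ∈∪⁻) ∈∪ˡ
          (add O ne (∉⊥ ∘ ∈∩ʳ ∘ proj₂) [])))

  -- The digraph of an orientation

  module Oriented (o : Vec Bool #E) where

    linkTail linkHead : Fin (#E + #A) → Vertex
    linkTail a = [ (λ e → tailOf (lookup o e) (ends e)) , tail ]′ (splitAt #E a)
    linkHead a = [ (λ e → headOf (lookup o e) (ends e)) , head ]′ (splitAt #E a)

    module _ (r∈U : ∀ i → r i ∈ U i) (closed : ∀ a i → linkTail a ∈ U i → linkHead a ∈ U i) where

      open Growing U r r∈U linkTail linkHead closed

      uncoloured : Colouring
      uncoloured = replicate _ nothing

      -- An oriented edge with its head in the inner set either starts outside `O` and is a spare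
      -- arc, or starts in `O`, hence in the atom of its head, and is an inside edge. The inside
      -- edges then cancel against those counted as gain.
      covered-initially : (∀ x → ¬ ∃ (Violated o x)) → Covered uncoloured
      covered-initially unviolated Γ at O (x , x∈) with isAtom-atom at (∈∩ʳ x∈)
      ... | refl = +-cancelʳ-≤ (insides Γ O) _ _ (begin
        W.wanted uncoloured Γ O + insides Γ O
          ≤⟨ +-monoˡ-≤ (insides Γ O) (∑-mono λ i → 𝟙-mono (W.wants? uncoloured Γ O i) (wants? Γ O i) λ w y y∈O →
               (λ y∈Γ → proj₁ (proj₁ (w y y∈O) y∈Γ) , proj₂ (proj₁ (w y y∈O) y∈Γ) ∘ inj₁) , proj₂ (w y y∈O)) ⟩
        gain Γ O
          ≤⟨ decidable-stable (_ ≤? _) (λ violated → unviolated x (O , (x , x∈) , violated)) ⟩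
        touching (map just o) (O ∩ Γ) + cost Γ O
          ≤⟨ +-monoˡ-≤ (cost Γ O) (≤-trans (∑-mono edge≤) (≤-reflexive (∑-+ (λ e → 𝟙 (spare? uncoloured Γ O (e ↑ˡ #A))) _))) ⟩
        ∑ (λ e → 𝟙 (spare? uncoloured Γ O (e ↑ˡ #A))) + insides Γ O + cost Γ O
          ≤⟨ +-monoʳ-≤ _ (∑-mono arc≤) ⟩
        ∑ (λ e → 𝟙 (spare? uncoloured Γ O (e ↑ˡ #A))) + insides Γ O + ∑ (λ a → 𝟙 (spare? uncoloured Γ O (#E ↑ʳ a)))
          ≡⟨ rearrange (∑ (λ e → 𝟙 (spare? uncoloured Γ O (e ↑ˡ #A)))) _ _ ⟩
        ∑ (λ e → 𝟙 (spare? uncoloured Γ O (e ↑ˡ #A))) + ∑ (λ a → 𝟙 (spare? uncoloured Γ O (#E ↑ʳ a))) + insides Γ O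
          ≡⟨ cong (_+ insides Γ O) (∑-splitAt #E (λ a → 𝟙 (spare? uncoloured Γ O a))) ⟨
        spare uncoloured Γ O + insides Γ O ∎)
        where
        open ≤-Reasoning
        rearrange : ∀ x y z → x + y + z ≡ x + z + y
        rearrange = solve-∀
        arc≤ : ∀ a → 𝟙 (leads-into? Γ (tail a) (head a) O) ≤ 𝟙 (spare? uncoloured Γ O (#E ↑ʳ a))
        arc≤ a = 𝟙-mono (leads-into? Γ (tail a) (head a) O) (spare? uncoloured Γ O (#E ↑ʳ a)) λ { (t∉ , h∈) →
          lookup-replicate (#E ↑ʳ a) nothing ,
          subst (λ s → [ _ , tail ]′ s ∉ O) (sym (splitAt-↑ʳ #E #A a)) t∉ ,
          subst (λ s → [ _ , head ]′ s ∈ O ∩ Γ) (sym (splitAt-↑ʳ #E #A a)) h∈ }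
        other-end : ∀ b e → tailOf b (ends e) ∈ O → headOf b (ends e) ∈ O ∩ Γ →
                    proj₁ (ends e) ∈ O ∩ Γ × proj₂ (ends e) ∈ O ∩ Γ
        other-end true  e t∈ h∈ = ∈∩⁺ t∈ (atom-closed at (∈∩ʳ h∈) λ i →
          mk⇔ (Equivalence.from (edge-closed e i)) (Equivalence.to (edge-closed e i))) , h∈
        other-end false e t∈ h∈ = h∈ , ∈∩⁺ t∈ (atom-closed at (∈∩ʳ h∈) (edge-closed e))
        edge≤ : ∀ e → 𝟙 (touches? (lookup (map just o) e) (ends e) (O ∩ Γ))
                      ≤ 𝟙 (spare? uncoloured Γ O (e ↑ˡ #A)) + 𝟙 (inside? Γ O e)
        edge≤ e rewrite lookup-map e just o = begin
          𝟙 (headOf (lookup o e) (ends e) ∈? (O ∩ Γ))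
            ≡⟨ +-identityʳ _ ⟨
          𝟙 (headOf (lookup o e) (ends e) ∈? (O ∩ Γ)) + 0
            ≤⟨ 𝟙-exchange (headOf (lookup o e) (ends e) ∈? (O ∩ Γ)) (⊥-dec {0ℓ}) (spare? uncoloured Γ O (e ↑ˡ #A)) (inside? Γ O e)
                 enters-or-inside (λ ()) (λ _ ()) ⟩
          𝟙 (spare? uncoloured Γ O (e ↑ˡ #A)) + 𝟙 (inside? Γ O e) ∎
          where
          enters-or-inside : headOf (lookup o e) (ends e) ∈ O ∩ Γ →
            (Free uncoloured (e ↑ˡ #A) × linkTail (e ↑ˡ #A) ∉ O × linkHead (e ↑ˡ #A) ∈ O ∩ Γ)
              ⊎ (proj₁ (ends e) ∈ O ∩ Γ × proj₂ (ends e) ∈ O ∩ Γ)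
          enters-or-inside h∈ rewrite splitAt-↑ˡ #E e #A with tailOf (lookup o e) (ends e) ∈? O
          ... | no t∉  = inj₁ (lookup-replicate (e ↑ˡ #A) nothing , t∉ , h∈)
          ... | yes t∈ = inj₂ (other-end (lookup o e) e t∈ h∈)

-- Walks and arborescences

module _ {a} {A : Set a} where

  unique-++ˡ : ∀ (xs : List A) {ys} → Unique (xs ++ ys) → Unique xs
  unique-++ˡ []       _          = []
  unique-++ˡ (x ∷ xs) (x∉ ∷ uniq) = ++⁻ˡ xs x∉ ∷ unique-++ˡ xs uniq

  unique-++-disjoint : ∀ {x} (xs : List A) {ys} → Unique (xs ++ ys) → x ∈ᴸ xs → ¬ x ∈ᴸ ys
  unique-++-disjoint (x ∷ xs) (x∉ ∷ _)    (here refl) x∈ys = All.lookup x∉ (∈-++⁺ʳ xs x∈ys) refl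
  unique-++-disjoint (_ ∷ xs) (_ ∷ uniq) (there x∈xs) x∈ys = unique-++-disjoint xs uniq x∈xs x∈ys

module Walks {F : MixedGraph} (H : Subgraph F) where
  open MixedGraph F
  open Subgraph H

  -- The visited vertices without the last, so that concatenating walks does not list the junction
  -- twice.
  starts : ∀ {u v} → Walk H u v → List Vertex
  starts     ε       = []
  starts {u} (_ ◅ w) = u ∷ starts w

  visited-◅◅ : ∀ {u v x} (p : Walk H u v) (w : Walk H v x) → visited H (p ◅◅ w) ≡ starts p ++ visited H w
  visited-◅◅ ε       w = refl
  visited-◅◅ (s ◅ p) w = cong (_ ∷_) (visited-◅◅ p w)

  visited≡starts : ∀ {u v} (p : Walk H u v) → visited H p ≡ starts p ++ v ∷ []
  visited≡starts ε       = refl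
  visited≡starts (s ◅ p) = cong (_ ∷_) (visited≡starts p)

  visited-snoc : ∀ {u v x} (p : Walk H u v) (s : Step H v x) →
                 visited H (p ◅◅ s ◅ ε) ≡ visited H p ++ x ∷ []
  visited-snoc {v = v} {x} p s = begin
    visited H (p ◅◅ s ◅ ε)         ≡⟨ visited-◅◅ p (s ◅ ε) ⟩
    starts p ++ (v ∷ [] ++ x ∷ []) ≡⟨ ++-assoc (starts p) _ _ ⟨
    (starts p ++ v ∷ []) ++ x ∷ [] ≡⟨ cong (_++ x ∷ []) (visited≡starts p) ⟨
    visited H p ++ x ∷ []          ∎
    where open ≡-Reasoning

  start∈visited : ∀ {u v} (w : Walk H u v) → u ∈ᴸ visited H w
  start∈visited ε       = here refl
  start∈visited (_ ◅ w) = here refl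

  length-snoc : ∀ {u v x} (p : Walk H u v) (s : Step H v x) →
                length (visited H (p ◅◅ s ◅ ε)) ≡ suc (length (visited H p))
  length-snoc p s = trans (cong length (visited-snoc p s))
                          (trans (length-++ (visited H p)) (+-comm (length (visited H p)) 1))

  isMixedPath-prefix : ∀ {u v x} (p : Walk H u v) (w : Walk H v x) →
                       IsMixedPath H (p ◅◅ w) → IsMixedPath H p
  isMixedPath-prefix p ε       uniq = unique-++ˡ (visited H p)
    (subst Unique (trans (visited-◅◅ p ε) (trans (sym (visited≡starts p)) (sym (++-identityʳ _)))) uniq)
  isMixedPath-prefix p (s ◅ w) uniq = unique-++ˡ (visited H p)
    (subst Unique (trans (visited-◅◅ p (s ◅ w))
      (trans (sym (++-assoc (starts p) (_ ∷ []) (visited H w))) (cong (_++ visited H w) (sym (visited≡starts p))))) uniq)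

  suffix : ∀ {u v x} (w : Walk H u v) → IsMixedPath H w → x ∈ᴸ visited H w → Reachable H x v
  suffix ε       uniq       (here refl) = ε , uniq
  suffix (s ◅ w) uniq       (here refl) = s ◅ w , uniq
  suffix (s ◅ w) (_ ∷ uniq) (there x∈) = suffix w uniq x∈

  -- Loop erasure: if the start recurs later, only the suffix from that recurrence is kept.
  reachable : ∀ {u v} → Walk H u v → Reachable H u v
  reachable ε = ε , [] ∷ []
  reachable {u} (s ◅ w) with reachable w
  ... | w′ , uniq with DecMembership._∈?_ _≟_ u (visited H w′)
  ...   | yes u∈ = suffix w′ uniq u∈
  ...   | no  u∉ = s ◅ w′ , ¬Any⇒All¬ _ u∉ ∷ uniq

  record Entrance (r : Vertex) (Q : Subset #V) : Set where
    field
      {before after} : Vertex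
      path    : Walk H r before
      step    : Step H before after
      simple  : IsMixedPath H (path ◅◅ step ◅ ε)
      before∉ : before ∉ Q
      after∈  : after ∈ Q

  -- The part already walked is carried along as `p`, so that the entering step ends a simple path
  -- from the root; uniqueness of paths in an arborescence is available only from there.
  entrance : ∀ {r u v Q} (p : Walk H r u) (w : Walk H u v) → IsMixedPath H (p ◅◅ w) →
             u ∉ Q → v ∈ Q → Entrance r Q
  entrance         p ε       uniq u∉ v∈ = contradiction v∈ u∉
  entrance {Q = Q} p (_◅_ {j = x} s w) uniq u∉ v∈ with x ∈? Q
  ... | yes x∈ = record { path = p ; step = s ; before∉ = u∉ ; after∈ = x∈
                        ; simple = isMixedPath-prefix (p ◅◅ s ◅ ε) w (subst (IsMixedPath H) (sym (◅◅-assoc p _ w)) uniq) }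
  ... | no  x∉ = entrance (p ◅◅ s ◅ ε) w (subst (IsMixedPath H) (sym (◅◅-assoc p _ w)) uniq) x∉ v∈

-- If the steps of H can be labelled by arcs with distinct heads, none of them
-- r, then a path from r never follows an arc backwards: that arc would be the
-- one just used to arrive.
module Branching {F : MixedGraph} (H : Subgraph F) (r : MixedGraph.Vertex F)
  {m : ℕ} (t h : Fin m → MixedGraph.Vertex F) (B : Fin m → Set)
  (label : ∀ {u v} → Step H u v → Fin m)
  (label∈B : ∀ {u v} (s : Step H u v) → B (label s))
  (direction : ∀ {u v} (s : Step H u v) → (t (label s) ≡ u × h (label s) ≡ v) ⊎ (t (label s) ≡ v × h (label s) ≡ u))
  (label-injective : ∀ {u v} → u ≢ v → (s s′ : Step H u v) → label s ≡ label s′ → s ≡ s′)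
  (heads-distinct : ∀ {a b} → B a → B b → h a ≡ h b → a ≡ b)
  (heads-not-root : ∀ {a} → B a → h a ≢ r)
  (loopless : ∀ {a} → B a → t a ≢ h a) where

  open MixedGraph F
  open Walks H

  Forward : ∀ {u v} → Step H u v → Set
  Forward {u} {v} s = t (label s) ≡ u × h (label s) ≡ v

  -- Walks are extended at the far end because a label is determined by its head: two directed walks
  -- to one vertex share their last step, and so on back to `r`.
  data Directed : ∀ {v} → Walk H r v → Set where
    stop : Directed ε
    snoc : ∀ {u v} {w : Walk H r u} → Directed w → (s : Step H u v) → Forward s → Directed (w ◅◅ s ◅ ε)

  directed-unique : ∀ {v} {p q : Walk H r v} → Directed p → Directed q → p ≡ q
  directed-unique stop         stop          = refl
  directed-unique stop         (snoc _ s (_ , h≡)) = contradiction h≡ (heads-not-root (label∈B s))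
  directed-unique (snoc _ s (_ , h≡)) stop   = contradiction h≡ (heads-not-root (label∈B s))
  directed-unique (snoc d s (t≡ , h≡)) (snoc d′ s′ (t≡′ , h≡′))
    with heads-distinct (label∈B s) (label∈B s′) (trans h≡ (sym h≡′))
  ... | l≡ with trans (sym t≡) (trans (cong t l≡) t≡′)
  ...   | refl = cong₂ (λ p s → p ◅◅ s ◅ ε) (directed-unique d d′)
                       (label-injective (λ u≡v → loopless (label∈B s) (trans t≡ (trans u≡v (sym h≡)))) s s′ l≡)

  directed-prefix : ∀ {v x} {p : Walk H r v} → Directed p → x ∈ᴸ visited H p →
    ∃ λ (q : Walk H r x) → Directed q × length (visited H q) ≤ length (visited H p)
  directed-prefix stop (here refl) = ε , stop , ≤-refl
  directed-prefix (snoc {w = w} d s f) x∈ with ∈-++⁻ (visited H w) (subst (_ ∈ᴸ_) (visited-snoc w s) x∈)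
  ... | inj₁ x∈w = let q , dq , le = directed-prefix d x∈w in
                   q , dq , ≤-trans le (≤-trans (n≤1+n _) (≤-reflexive (sym (length-snoc w s))))
  ... | inj₂ (here refl) = w ◅◅ s ◅ ε , snoc d s f , ≤-refl

  -- If the new end had been visited before, a directed walk no longer than `w` would lead to it; by
  -- uniqueness that walk is `w` followed by `s`, which is longer.
  directed-simple : ∀ {v} {p : Walk H r v} → Directed p → IsMixedPath H p
  directed-simple stop = [] ∷ []
  directed-simple (snoc {v = v} {w} d s f) = subst Unique (sym (visited-snoc w s))
    (++⁺ (directed-simple d) ([] ∷ []) λ { (x∈ , here refl) → revisit (directed-prefix d x∈) })
    where
    revisit : ¬ ∃ λ (q : Walk H r v) → Directed q × length (visited H q) ≤ length (visited H w)
    revisit (q , dq , le) with directed-unique dq (snoc d s f)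
    ... | refl = <⇒≱ (≤-reflexive (sym (length-snoc w s))) le

  private
    backtrack : ∀ {x y z} {p : Walk H r x} (s : Step H x y) (w : Walk H y z) →
                t (label s) ≡ y → h (label s) ≡ x → Directed p → ¬ IsMixedPath H (p ◅◅ s ◅ w)
    backtrack s w _ h≡ stop _ = heads-not-root (label∈B s) h≡
    backtrack {y = y} s w t≡ h≡ (snoc {u = u} {w = p} d s′ (t≡′ , h≡′)) uniq =
      unique-++-disjoint (starts (p ◅◅ s′ ◅ ε)) (subst Unique (visited-◅◅ (p ◅◅ s′ ◅ ε) (s ◅ w)) uniq)
        (subst (_∈ᴸ starts (p ◅◅ s′ ◅ ε)) u≡y (last∈starts p))
        (there (start∈visited w))
      where
      u≡y : u ≡ y
      u≡y = trans (sym t≡′) (trans (cong t (heads-distinct (label∈B s′) (label∈B s) (trans h≡′ (sym h≡)))) t≡)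
      last∈starts : ∀ {u v x} (p : Walk H u v) {s : Step H v x} → v ∈ᴸ starts (p ◅◅ s ◅ ε)
      last∈starts ε       = here refl
      last∈starts (_ ◅ p) = there (last∈starts p)

  simple-directed : ∀ {x v} {p : Walk H r x} → Directed p → (w : Walk H x v) →
                    IsMixedPath H (p ◅◅ w) → Directed (p ◅◅ w)
  simple-directed {p = p} d ε uniq = subst Directed (sym (◅◅-identityʳ p)) d
    where
    ◅◅-identityʳ : ∀ {u v} (p : Walk H u v) → p ◅◅ ε ≡ p
    ◅◅-identityʳ ε       = refl
    ◅◅-identityʳ (s ◅ p) = cong (s ◅_) (◅◅-identityʳ p)
  simple-directed {p = p} d (s ◅ w) uniq with direction s
  ... | inj₁ f = subst Directed (◅◅-assoc p (s ◅ ε) w)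
      (simple-directed (snoc d s f) w (subst (IsMixedPath H) (sym (◅◅-assoc p (s ◅ ε) w)) uniq))
  ... | inj₂ (t≡ , h≡) = contradiction uniq (backtrack s w t≡ h≡ d)

  directed⇒∃! : ∀ {v} {p : Walk H r v} → Directed p → ∃! _≡_ (λ (w : Walk H r v) → IsMixedPath H w)
  directed⇒∃! {p = p} d = p , directed-simple d , λ {w} uniq → directed-unique d (simple-directed stop w uniq)

-- Sufficiency and necessity

module Sufficiency (F : MixedGraph) {k : ℕ} (r : Fin k → MixedGraph.Vertex F) (U : Fin k → Subset (MixedGraph.#V F))
  (reach : IsReachableFamily F r U) where

  open MixedGraph F
  open Equivalence

  step-closed : ∀ {u v} i → Step (whole F) u v → u ∈ U i → v ∈ U i
  step-closed i s u∈ = from (reach i _) (Walks.reachable (whole F) (proj₁ (to (reach i _) u∈) ◅◅ s ◅ ε))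

  r∈U : ∀ i → r i ∈ U i
  r∈U i = from (reach i _) (ε , [] ∷ [])

  edge-closed : ∀ e i → proj₁ (ends e) ∈ U i ⇔ proj₂ (ends e) ∈ U i
  edge-closed e i = mk⇔ (step-closed i (edge e ∈⊤ (inj₁ refl))) (step-closed i (edge e ∈⊤ (inj₂ refl)))

  open Orienting F r U edge-closed

  module Trees (o : Vec Bool #E) (unviolated : ∀ x → ¬ ∃ (Violated o x)) where
    open Oriented o

    closed : ∀ a i → linkTail a ∈ U i → linkHead a ∈ U i
    closed a i with splitAt #E a
    ... | inj₂ b = step-closed i (arc b ∈⊤ refl refl)
    ... | inj₁ e with lookup o e
    ...   | true  = to (edge-closed e i)
    ...   | false = from (edge-closed e i)

    open Growing U r r∈U linkTail linkHead closed

    not-coloured : ∀ {i a} → ¬ Coloured (uncoloured r∈U closed) i a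
    not-coloured {a = a} ca = case trans (sym (lookup-replicate a nothing)) ca of λ ()

    spanning-forest : ∃ λ col → Forest col × Spanning col
    spanning-forest = complete (uncoloured r∈U closed) (<-wellFounded _) (covered-initially r∈U closed unviolated) record
      { heads-distinct = λ ca → ⊥-elim (not-coloured ca)
      ; heads-not-root = λ ca → ⊥-elim (not-coloured ca)
      ; loopless       = λ ca → ⊥-elim (not-coloured ca)
      ; tail-grown     = λ ca → ⊥-elim (not-coloured ca) }

    col      = proj₁ spanning-forest
    forest   = proj₁ (proj₂ spanning-forest)
    spanned  = proj₂ (proj₂ spanning-forest)
    open Forest forest

    coloured? : ∀ i → Decidable (Coloured col i)
    coloured? i a = Maybe-≡-dec _≟_ (lookup col a) (just i)

    edge∈? : ∀ i → Decidable (λ e → Coloured col i (e ↑ˡ #A))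
    edge∈? i e = coloured? i (e ↑ˡ #A)

    arc∈? : ∀ i → Decidable (λ a → Coloured col i (#E ↑ʳ a))
    arc∈? i a = coloured? i (#E ↑ʳ a)

    ends∈U : ∀ {i a} → Coloured col i a → linkTail a ∈ U i × linkHead a ∈ U i
    ends∈U {i} {a} ca = let t∈ = grown⊆U (tail-grown ca) in t∈ , closed a i t∈

    edge-ends∈U : ∀ {i e} → Coloured col i (e ↑ˡ #A) → proj₁ (ends e) ∈ U i × proj₂ (ends e) ∈ U i
    edge-ends∈U {i} {e} ce with ends∈U ce
    ... | t∈ , h∈ rewrite splitAt-↑ˡ #E e #A with lookup o e
    ...   | true  = t∈ , h∈
    ...   | false = h∈ , t∈

    arc-ends∈U : ∀ {i a} → Coloured col i (#E ↑ʳ a) → tail a ∈ U i × head a ∈ U i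
    arc-ends∈U {i} {a} ca with ends∈U ca
    ... | both rewrite splitAt-↑ʳ #E #A a = both

    tree : Fin k → Subgraph F
    tree i = record
      { verts = U i ; edges = ⟪ edge∈? i ⟫ ; arcs = ⟪ arc∈? i ⟫
      ; edges-closed = λ e∈ → edge-ends∈U (∈⟪⟫⁻ (edge∈? i) e∈)
      ; arcs-closed = λ a∈ → arc-ends∈U (∈⟪⟫⁻ (arc∈? i) a∈) }

    module _ (i : Fin k) where

      label : ∀ {u v} → Step (tree i) u v → Fin (#E + #A)
      label (arc a _ _ _)  = #E ↑ʳ a
      label (edge e _ _)   = e ↑ˡ #A

      label-coloured : ∀ {u v} (s : Step (tree i) u v) → Coloured col i (label s)
      label-coloured (arc a a∈ _ _) = ∈⟪⟫⁻ (arc∈? i) a∈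
      label-coloured (edge e e∈ _)  = ∈⟪⟫⁻ (edge∈? i) e∈

      direction : ∀ {u v} (s : Step (tree i) u v) →
        (linkTail (label s) ≡ u × linkHead (label s) ≡ v) ⊎ (linkTail (label s) ≡ v × linkHead (label s) ≡ u)
      direction (arc a _ refl refl) rewrite splitAt-↑ʳ #E #A a = inj₁ (refl , refl)
      direction (edge e _ eq) rewrite splitAt-↑ˡ #E e #A with lookup o e | eq
      ... | true  | inj₁ refl = inj₁ (refl , refl)
      ... | true  | inj₂ refl = inj₂ (refl , refl)
      ... | false | inj₁ refl = inj₂ (refl , refl)
      ... | false | inj₂ refl = inj₁ (refl , refl)

      -- A loop gives two steps with one label, as its ends match in either order; the hypothesis
      -- `u ≢ v` excludes this.
      label-injective : ∀ {u v} → u ≢ v → (s s′ : Step (tree i) u v) → label s ≡ label s′ → s ≡ s′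
      label-injective _ (arc a a∈ refl refl) (arc b b∈ t≡ h≡) eq with ↑ʳ-injective #E a b eq
      ... | refl rewrite []=-irrelevant a∈ b∈ | ≡-irrelevant t≡ refl | ≡-irrelevant h≡ refl = refl
      label-injective u≢v (edge e e∈ eqs) (edge f f∈ eqs′) eq with ↑ˡ-injective #A e f eq
      ... | refl rewrite []=-irrelevant e∈ f∈ = cong (edge e f∈) (same eqs eqs′)
        where
        same : (p q : _ ⊎ _) → p ≡ q
        same (inj₁ p) (inj₁ q) = cong inj₁ (≡-irrelevant p q)
        same (inj₂ p) (inj₂ q) = cong inj₂ (≡-irrelevant p q)
        same (inj₁ p) (inj₂ q) = contradiction (cong proj₁ (trans (sym p) q)) u≢v
        same (inj₂ p) (inj₁ q) = contradiction (cong proj₁ (trans (sym q) p)) u≢v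
      label-injective _ (arc a _ _ _) (edge e _ _) eq =
        case trans (sym (splitAt-↑ʳ #E #A a)) (trans (cong (splitAt #E) eq) (splitAt-↑ˡ #E e #A)) of λ ()
      label-injective _ (edge e _ _) (arc a _ _ _) eq =
        case trans (sym (splitAt-↑ˡ #E e #A)) (trans (cong (splitAt #E) eq) (splitAt-↑ʳ #E #A a)) of λ ()

      link-step : ∀ a → Coloured col i a → Σ (Step (tree i) (linkTail a) (linkHead a)) λ s → label s ≡ a
      link-step a ca with splitAt #E a in eq
      ... | inj₂ b = arc b (∈⟪⟫⁺ (arc∈? i) (subst (Coloured col i) (sym (splitAt⁻¹-↑ʳ eq)) ca)) refl refl , splitAt⁻¹-↑ʳ eq
      ... | inj₁ e = edge e (∈⟪⟫⁺ (edge∈? i) (subst (Coloured col i) (sym (splitAt⁻¹-↑ˡ eq)) ca)) (which (lookup o e)) , splitAt⁻¹-↑ˡ eq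
        where
        which : ∀ b → ends e ≡ (tailOf b (ends e) , headOf b (ends e)) ⊎ ends e ≡ (headOf b (ends e) , tailOf b (ends e))
        which true  = inj₁ refl
        which false = inj₂ refl

      open Branching (tree i) (r i) linkTail linkHead (Coloured col i) label label-coloured direction
        label-injective heads-distinct heads-not-root loopless

      directed : ∀ {v} → Grown col i v → ∃ λ (w : Walk (tree i) (r i) v) → Directed w
      directed root          = ε , stop
      directed (grow a ca g) with directed g | link-step a ca
      ... | w , d | s , label≡ = w ◅◅ s ◅ ε , snoc d s (cong linkTail label≡ , cong linkHead label≡)

      arborescence : IsArborescence (tree i) (r i)
      arborescence v v∈ = directed⇒∃! (proj₂ (directed (grown (spanned i v v∈))))

    packing : Packing F r U
    packing = record
      { tree = tree ; arborescence = arborescence ; spanning = λ i → refl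
      ; edges-disjoint = λ i j i≢j → λ { (e , e∈) → i≢j (just-injective
          (trans (sym (∈⟪⟫⁻ (edge∈? i) (∈∩ˡ e∈))) (∈⟪⟫⁻ (edge∈? j) (∈∩ʳ e∈)))) }
      ; arcs-disjoint = λ i j i≢j → λ { (a , a∈) → i≢j (just-injective
          (trans (sym (∈⟪⟫⁻ (arc∈? i) (∈∩ˡ a∈))) (∈⟪⟫⁻ (arc∈? j) (∈∩ʳ a∈)))) } }

  packing : Condition → Packing F r U
  packing condition = let o , unviolated = orientation condition in Trees.packing o unviolated

-- Necessity: charging demands to entering links

module Necessity (F : MixedGraph) {k : ℕ} (r : Fin k → MixedGraph.Vertex F) (U : Fin k → Subset (MixedGraph.#V F))
  (packing : Packing F r U) where

  open MixedGraph F
  open Packing packing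
  open Subgraph

  module _ {t : ℕ} (X : Fin t → BiSet #V)
    (nonempty : ∀ s → Nonempty (inner (X s)))
    (disjoint : ∀ s s′ → s ≢ s′ → Empty (inner (X s) ∩ inner (X s′))) where

    entry : ∀ s i → Demands r U (X s) i → Walks.Entrance (tree i) (r i) (inner (X s))
    entry s i (inner⊆U , r∉ , _) =
      let x , x∈ = nonempty s
          w , simple , _ = arborescence i x (subst (x ∈_) (sym (spanning i)) (inner⊆U x∈))
      in Walks.entrance (tree i) ε w simple r∉ x∈

    carrier : ∀ {i u v} → Step (tree i) u v → Edge ⊎ Arc
    carrier (edge e _ _)  = inj₁ e
    carrier (arc a _ _ _) = inj₂ a

    -- Each demanded pair is charged to one link only. The decision is an argument so that the link
    -- comes from one fixed proof of the demand.
    entered-by : ∀ {s i} → Dec (Demands r U (X s) i) → Maybe (Edge ⊎ Arc)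
    entered-by {s} {i} (yes d) = just (carrier (Walks.Entrance.step (entry s i d)))
    entered-by         (no _)  = nothing

    Via : Edge ⊎ Arc → Fin t → Fin k → Set
    Via ℓ s i = entered-by (demands? r U (X s) i) ≡ just ℓ

    via? : ∀ ℓ s → Decidable (Via ℓ s)
    via? ℓ s i = Maybe-≡-dec (⊎-≡-dec _≟_ _≟_) _ (just ℓ)

    via⇒entry : ∀ {ℓ s i} → Via ℓ s i →
      ∃ λ (d : Demands r U (X s) i) → carrier (Walks.Entrance.step (entry s i d)) ≡ ℓ
    via⇒entry {s = s} {i} eq = split (demands? r U (X s) i) eq
      where
      split : ∀ {ℓ} (d? : Dec (Demands r U (X s) i)) → entered-by d? ≡ just ℓ →
              ∃ λ (d : Demands r U (X s) i) → carrier (Walks.Entrance.step (entry s i d)) ≡ ℓ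
      split (yes d) eq = d , just-injective eq

    inner-unique : ∀ {x} s s′ → x ∈ inner (X s) → x ∈ inner (X s′) → s ≡ s′
    inner-unique s s′ x∈ x∈′ = decidable-stable (s ≟ s′) λ s≢s′ → disjoint s s′ s≢s′ (_ , ∈∩⁺ x∈ x∈′)

    module _ {i : Fin k} where
      open Walks (tree i)

      carrier-edge : ∀ {u v e} (s : Step (tree i) u v) → carrier s ≡ inj₁ e →
                     e ∈ edges (tree i) × (ends e ≡ (u , v) ⊎ ends e ≡ (v , u))
      carrier-edge (edge e e∈ eqs) refl = e∈ , eqs

      carrier-arc : ∀ {u v a} (s : Step (tree i) u v) → carrier s ≡ inj₂ a →
                    a ∈ arcs (tree i) × tail a ≡ u × head a ≡ v
      carrier-arc (arc a a∈ t≡ h≡) refl = a∈ , t≡ , h≡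

      path-unique : ∀ {v} (p q : Walk (tree i) (r i) v) → v ∈ verts (tree i) →
                    IsMixedPath (tree i) p → IsMixedPath (tree i) q → p ≡ q
      path-unique p q v∈ simple-p simple-q =
        let _ , _ , unique = arborescence i _ v∈ in trans (sym (unique simple-p)) (unique simple-q)

      -- By uniqueness of paths, each of `p` and `q` would be the other with one step appended, so
      -- `p` would be longer than itself by two.
      no-return : ∀ {u v} (p : Walk (tree i) (r i) u) (s : Step (tree i) u v)
        (q : Walk (tree i) (r i) v) (s′ : Step (tree i) v u) → u ∈ verts (tree i) → v ∈ verts (tree i) →
        IsMixedPath (tree i) (p ◅◅ s ◅ ε) → ¬ IsMixedPath (tree i) (q ◅◅ s′ ◅ ε)
      no-return p s q s′ u∈ v∈ simple simple′ = m≢1+n+m (length (visited (tree i) p)) {1} (begin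
        length (visited (tree i) p)               ≡⟨ cong (length ∘ visited (tree i)) p≡ ⟩
        length (visited (tree i) (q ◅◅ s′ ◅ ε))   ≡⟨ length-snoc q s′ ⟩
        suc (length (visited (tree i) q))         ≡⟨ cong (suc ∘ length ∘ visited (tree i)) q≡ ⟩
        suc (length (visited (tree i) (p ◅◅ s ◅ ε))) ≡⟨ cong suc (length-snoc p s) ⟩
        2 + length (visited (tree i) p)           ∎)
        where
        open ≡-Reasoning
        p≡ : p ≡ q ◅◅ s′ ◅ ε
        p≡ = path-unique p _ u∈ (isMixedPath-prefix p (s ◅ ε) simple) simple′
        q≡ : q ≡ p ◅◅ s ◅ ε
        q≡ = path-unique q _ v∈ (isMixedPath-prefix q (s′ ◅ ε) simple′) simple

      -- Paths of a tree cross an edge in one direction only.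
      same-direction : ∀ {e Q Q′} (E : Entrance (r i) Q) (E′ : Entrance (r i) Q′) →
        carrier (Entrance.step E) ≡ inj₁ e → carrier (Entrance.step E′) ≡ inj₁ e →
        Entrance.after E ≡ Entrance.after E′
      same-direction {e} record { path = p ; step = s ; simple = simple } record { path = q ; step = s′ ; simple = simple′ } c≡ c≡′
        with carrier-edge s c≡ | carrier-edge s′ c≡′
      ... | _  , inj₁ eq | _ , inj₁ eq′ = cong proj₂ (trans (sym eq) eq′)
      ... | _  , inj₂ eq | _ , inj₂ eq′ = cong proj₁ (trans (sym eq) eq′)
      ... | e∈ , inj₁ eq | _ , inj₂ eq′ with trans (sym eq) eq′
      ...   | refl = contradiction simple′ (no-return p s q s′
                       (subst (_∈ verts (tree i)) (cong proj₁ eq) (proj₁ (edges-closed (tree i) e∈)))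
                       (subst (_∈ verts (tree i)) (cong proj₂ eq) (proj₂ (edges-closed (tree i) e∈))) simple)
      same-direction {e} record { path = p ; step = s ; simple = simple } record { path = q ; step = s′ ; simple = simple′ } c≡ c≡′
          | e∈ , inj₂ eq | _ , inj₁ eq′ with trans (sym eq) eq′
      ...   | refl = contradiction simple′ (no-return p s q s′
                       (subst (_∈ verts (tree i)) (cong proj₂ eq) (proj₂ (edges-closed (tree i) e∈)))
                       (subst (_∈ verts (tree i)) (cong proj₁ eq) (proj₁ (edges-closed (tree i) e∈))) simple)

    via-edge⇒∈ : ∀ {e s i} → Via (inj₁ e) s i → e ∈ edges (tree i)
    via-edge⇒∈ via = proj₁ (carrier-edge _ (proj₂ (via⇒entry via)))

    via-edge-colour : ∀ {e s s′ i j} → Via (inj₁ e) s i → Via (inj₁ e) s′ j → i ≡ j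
    via-edge-colour {i = i} {j} via via′ = decidable-stable (i ≟ j) λ i≢j →
      edges-disjoint i j i≢j (_ , ∈∩⁺ (via-edge⇒∈ via) (via-edge⇒∈ via′))

    via-edge-crosses : ∀ {e s i} → Via (inj₁ e) s i → Crosses F (inner ∘ X) e
    via-edge-crosses {e} {s} {i} via with via⇒entry via
    ... | d , c≡ with entry s i d
    ...   | record { step = st ; before∉ = b∉ ; after∈ = a∈ } with carrier-edge st c≡
    ...     | _ , inj₁ eq = s , inj₂ (subst (_∉ inner (X s)) (sym (cong proj₁ eq)) b∉ , subst (_∈ inner (X s)) (sym (cong proj₂ eq)) a∈)
    ...     | _ , inj₂ eq = s , inj₁ (subst (_∈ inner (X s)) (sym (cong proj₁ eq)) a∈ , subst (_∉ inner (X s)) (sym (cong proj₂ eq)) b∉)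

    -- Disjointness of the trees leaves one colour, the common direction of travel one vertex of
    -- arrival, and disjointness of the inner sets one part containing it.
    via-edge-part : ∀ {e s s′ i j} → Via (inj₁ e) s i → Via (inj₁ e) s′ j → s ≡ s′
    via-edge-part {s = s} {s′} {i} via via′ with via-edge-colour via via′
    ... | refl =
      let d  , c≡  = via⇒entry via
          d′ , c≡′ = via⇒entry via′
          E  = entry s i d
          E′ = entry s′ i d′
      in inner-unique s s′ (Walks.Entrance.after∈ E)
           (subst (_∈ inner (X s′)) (sym (same-direction E E′ c≡ c≡′)) (Walks.Entrance.after∈ E′))

    via-arc⇒∈ : ∀ {a s i} → Via (inj₂ a) s i → a ∈ arcs (tree i)
    via-arc⇒∈ via = proj₁ (carrier-arc _ (proj₂ (via⇒entry via)))

    via-arc-colour : ∀ {a s s′ i j} → Via (inj₂ a) s i → Via (inj₂ a) s′ j → i ≡ j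
    via-arc-colour {i = i} {j} via via′ = decidable-stable (i ≟ j) λ i≢j →
      arcs-disjoint i j i≢j (_ , ∈∩⁺ (via-arc⇒∈ via) (via-arc⇒∈ via′))

    -- The tail belongs to the tree and hence to `U i`, which the wall of a demanding bi-set avoids;
    -- being outside the inner set, it is outside the outer set.
    via-arc-enters : ∀ {a s i} → Via (inj₂ a) s i → Enters F (X s) a
    via-arc-enters {a} {s} {i} via with via⇒entry via
    ... | d@(_ , _ , wall#U) , c≡ with entry s i d
    ...   | record { step = st ; before∉ = b∉ ; after∈ = a∈ } with carrier-arc st c≡
    ...     | arc∈ , refl , refl =
      (λ t∈O → wall#U (_ , ∈∩⁺ (x∈p∧x∉q⇒x∈p─q t∈O b∉) (subst (tail a ∈_) (spanning i) (proj₁ (arcs-closed (tree i) arc∈))))) , a∈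

    -- The bound is over all parts at once, because `eE` counts a crossing edge once even if it
    -- joins two parts; for arcs one bound per part is enough, since each part has its own `ρ`.
    ∑-via-edge : ∀ e → ∑ (λ s → ∑ (λ i → 𝟙 (via? (inj₁ e) s i))) ≤ 𝟙 (crosses? F (inner ∘ X) e)
    ∑-via-edge e = ≤-trans
      (∑-mono λ s → ∑-at-most-one (via? (inj₁ e) s) (any? (via? (inj₁ e) s)) _,_ λ _ _ → via-edge-colour)
      (∑-at-most-one (λ s → any? (via? (inj₁ e) s)) (crosses? F (inner ∘ X) e)
        (λ _ → via-edge-crosses ∘ proj₂) λ _ _ v v′ → via-edge-part (proj₂ v) (proj₂ v′))

    ∑-via-arc : ∀ s a → ∑ (λ i → 𝟙 (via? (inj₂ a) s i)) ≤ 𝟙 (enters? F (X s) a)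
    ∑-via-arc s a = ∑-at-most-one (via? (inj₂ a) s) (enters? F (X s) a) (λ _ → via-arc-enters) λ _ _ → via-arc-colour

    demanded : ∀ s i → 𝟙 (demands? r U (X s) i)
                       ≤ ∑ (λ e → 𝟙 (via? (inj₁ e) s i)) + ∑ (λ a → 𝟙 (via? (inj₂ a) s i))
    demanded s i = carried (entered-by (demands? r U (X s) i)) refl
      where
      open ≤-Reasoning
      carried : ∀ m → entered-by (demands? r U (X s) i) ≡ m → 𝟙 (demands? r U (X s) i)
                ≤ ∑ (λ e → 𝟙 (via? (inj₁ e) s i)) + ∑ (λ a → 𝟙 (via? (inj₂ a) s i))
      carried nothing eq = subst (_≤ ∑ (λ e → 𝟙 (via? (inj₁ e) s i)) + ∑ (λ a → 𝟙 (via? (inj₂ a) s i)))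
        (sym (𝟙-no (demands? r U (X s) i) (idle (demands? r U (X s) i) eq))) z≤n
        where
        idle : (d? : Dec (Demands r U (X s) i)) → entered-by d? ≡ nothing → ¬ Demands r U (X s) i
        idle (no ¬d) _ = ¬d
      carried (just (inj₁ e)) eq = begin
        𝟙 (demands? r U (X s) i)            ≤⟨ 𝟙-mono (demands? r U (X s) i) (via? (inj₁ e) s i) (λ _ → eq) ⟩
        𝟙 (via? (inj₁ e) s i)               ≤⟨ ≤-∑ (λ e → 𝟙 (via? (inj₁ e) s i)) e ⟩
        ∑ (λ e → 𝟙 (via? (inj₁ e) s i))     ≤⟨ m≤m+n _ _ ⟩
        _                                    ∎
      carried (just (inj₂ a)) eq = begin
        𝟙 (demands? r U (X s) i)            ≤⟨ 𝟙-mono (demands? r U (X s) i) (via? (inj₂ a) s i) (λ _ → eq) ⟩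
        𝟙 (via? (inj₂ a) s i)               ≤⟨ ≤-∑ (λ a → 𝟙 (via? (inj₂ a) s i)) a ⟩
        ∑ (λ a → 𝟙 (via? (inj₂ a) s i))     ≤⟨ m≤n+m _ _ ⟩
        _                                    ∎

    demand≤ : ∑ (λ s → demand r U (X s)) ≤ eE F (inner ∘ X) + ∑ (λ s → ρ F (X s))
    demand≤ = begin
      ∑ (λ s → demand r U (X s))
        ≡⟨ ∑-cong (λ s → #≡∑ (demands? r U (X s))) ⟩
      ∑ (λ s → ∑ (λ i → 𝟙 (demands? r U (X s) i)))
        ≤⟨ ∑-mono (λ s → ≤-trans (∑-mono (demanded s)) (≤-reflexive
             (∑-+ (λ i → ∑ (λ e → 𝟙 (via? (inj₁ e) s i))) (λ i → ∑ (λ a → 𝟙 (via? (inj₂ a) s i)))))) ⟩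
      ∑ (λ s → ∑ (λ i → ∑ (λ e → 𝟙 (via? (inj₁ e) s i))) + ∑ (λ i → ∑ (λ a → 𝟙 (via? (inj₂ a) s i))))
        ≡⟨ ∑-+ (λ s → ∑ (λ i → ∑ (λ e → 𝟙 (via? (inj₁ e) s i)))) (λ s → ∑ (λ i → ∑ (λ a → 𝟙 (via? (inj₂ a) s i)))) ⟩
      ∑ (λ s → ∑ (λ i → ∑ (λ e → 𝟙 (via? (inj₁ e) s i)))) + ∑ (λ s → ∑ (λ i → ∑ (λ a → 𝟙 (via? (inj₂ a) s i))))
        ≡⟨ cong₂ _+_ (trans (∑-cong (λ s → ∑-swap (λ i e → 𝟙 (via? (inj₁ e) s i)))) (∑-swap (λ s e → ∑ (λ i → 𝟙 (via? (inj₁ e) s i)))))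
                     (∑-cong (λ s → ∑-swap (λ i a → 𝟙 (via? (inj₂ a) s i)))) ⟩
      ∑ (λ e → ∑ (λ s → ∑ (λ i → 𝟙 (via? (inj₁ e) s i)))) + ∑ (λ s → ∑ (λ a → ∑ (λ i → 𝟙 (via? (inj₂ a) s i))))
        ≤⟨ +-mono-≤ (∑-mono ∑-via-edge) (∑-mono (λ s → ∑-mono (∑-via-arc s))) ⟩
      ∑ (λ e → 𝟙 (crosses? F (inner ∘ X) e)) + ∑ (λ s → ∑ (λ a → 𝟙 (enters? F (X s) a)))
        ≡⟨ cong₂ _+_ (#≡∑ (crosses? F (inner ∘ X))) (∑-cong (λ s → #≡∑ (enters? F (X s)))) ⟨
      eE F (inner ∘ X) + ∑ (λ s → ρ F (X s)) ∎
      where open ≤-Reasoning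

theorem4 : (F : MixedGraph) (let open MixedGraph F) →
    (k : ℕ) (r : Fin k → Vertex) (U : Fin k → Subset #V) →
    IsReachableFamily F r U →
    Packing F r U ⇔
    ((t : ℕ) (X : Fin t → BiSet #V) (Γ : Subset #V) →
    IsAtom U Γ →
    IsSubpartition Γ (inner ∘ X) →
    (∀ s → Empty (wall (X s) ∩ Γ)) →
    eE F (inner ∘ X) + ∑ (λ s → ρ F (X s)) ≥ ∑ (λ s → demand r U (X s)))
theorem4 F k r U reach = mk⇔
  (λ packing t X Γ _ P _ → Necessity.demand≤ F r U packing X (IsSubpartition.nonempty P) (IsSubpartition.disjoint P))
  (Sufficiency.packing F r U reach)
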